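{- Let $D_0$ be the edge-ordered graph on the four vertices $a,b,v,w$ with exactly the five edges $ab,av,aw,bw,bv$, ordered by $l(ab)<l(av)<l(aw)<l(bw)<l(bv)$. Let $G$ be a fixed edge-ordered graph, and let $D_0+G$ be the vertex-disjoint union of $D_0$ and $G$, edge-ordered so that $l(D_0)<l(G)$ (and with the given orders on $D_0$ and $G$). Then \[\Omega(n\sqrt{\log n})=ssat_m(n,D_0+G)\ \le\ sat_m(n,D_0+G)=O\left(n\,\frac{\log n}{\log\log n}\right).\]
   Context: An edge-ordered graph is a finite simple graph together with a linear order on its edge set given by an injective labeling $l$ to $\mathbb{N}$ or $\mathbb{R}$. An edge-ordered graph $H$ contains $F$ (has a copy of $F$) if $F$ is isomorphic, by an isomorphism respecting the edge-order, to a subgraph of $H$ with the induced order; otherwise $H$ is $F$-free. $l(F_1)<l(F_2)$ means that all labels of edges of $F_1$ are smaller than all labels of edges of $F_2$. $ssat_m(n,F)$ is the minimum number of edges in an edge-ordered graph $H$ on $n$ vertices such that adding to $H$ any missing edge, inserted at the beginning of the linear order (i.e. with a label smaller than all labels of $H$), creates a new copy of $F$ (one using the added edge). $sat_m(n,F)$ is defined in the same way with the additional requirement that $H$ is $F$-free. Asymptotic notation is for $n\to\infty$ with $G$ fixed; "$\Omega(f)=g$" means $g=\Omega(f)$. -}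

module Defs where

open import Data.Empty using (⊥)
open import Data.Fin.Base as Fin using (Fin; zero; suc; toℕ; _↑ˡ_; _↑ʳ_)
open import Data.Fin.Patterns using (0F; 1F; 2F; 3F)
open import Data.Fin.Properties
  using (toℕ<n; toℕ-↑ˡ; toℕ-↑ʳ; ↑ˡ-injective; ↑ʳ-injective)
open import Data.List.Base using (List; []; _∷_; _++_; map; length; lookup)
open import Data.List.Membership.Propositional using (_∉_)
open import Data.List.Membership.Propositional.Properties using (∈-map⁻)
open import Data.List.Relation.Unary.All using ([]; _∷_)
open import Data.List.Relation.Unary.All.Properties using (¬Any⇒All¬)
open import Data.List.Relation.Unary.AllPairs using ([]; _∷_)
open import Data.List.Relation.Unary.Unique.Propositional using (Unique)
import Data.List.Relation.Unary.Unique.Propositional.Properties as Unique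
open import Data.Nat.Base using (ℕ; _+_; _*_; _^_; _≤_; z≤n; s≤s)
import Data.Nat.Base as ℕ
open import Data.Nat.Logarithm using (⌊log₂_⌋)
import Data.Nat.Properties as ℕ
open import Data.Product.Base using (Σ-syntax; ∃-syntax; _×_; _,_)
open import Data.Sum.Base using (_⊎_)
open import Function.Definitions using (Injective)
open import Relation.Binary.Core using (_Preserves_⟶_)
open import Relation.Binary.PropositionalEquality
  using (_≡_; refl; sym; trans; cong; subst₂)
open import Relation.Nullary.Negation using (¬_)

-- An unordered pair of distinct vertices, stored with the smaller one first.
-- As src<tgt is irrelevant, two edges are equal as soon as their ends are.
record Edge (n : ℕ) : Set where
  constructor edge
  field
    src tgt  : Fin n
    .src<tgt : src Fin.< tgt

open Edge public

_Joins_and_ : ∀ {n} → Edge n → Fin n → Fin n → Set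
e Joins u and v = (src e ≡ u × tgt e ≡ v) ⊎ (src e ≡ v × tgt e ≡ u)

-- A simple graph on the vertex set Fin n whose edge set is linearly ordered.
-- The edges are listed in increasing order, so the position of an edge in the
-- list serves as its label.  Only the order of the labels ever matters, so no
-- other labelling has to be recorded.
record EdgeOrderedGraph (n : ℕ) : Set where
  constructor graph
  field
    edges  : List (Edge n)
    unique : Unique edges

open EdgeOrderedGraph public

size : ∀ {n} → EdgeOrderedGraph n → ℕ
size H = length (edges H)

Label : ∀ {n} → EdgeOrderedGraph n → Set
Label H = Fin (size H)

edgeAt : ∀ {n} (H : EdgeOrderedGraph n) → Label H → Edge n
edgeAt H = lookup (edges H)

-- An order-respecting isomorphism of F onto a (not necessarily induced)
-- subgraph of H.
record Copy {m n : ℕ} (F : EdgeOrderedGraph m) (H : EdgeOrderedGraph n) : Set where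
  field
    vertexMap           : Fin m → Fin n
    vertexMap-injective : Injective _≡_ _≡_ vertexMap
    labelMap            : Label F → Label H
    labelMap-mono       : labelMap Preserves Fin._<_ ⟶ Fin._<_
    incident            : ∀ i → edgeAt H (labelMap i)
                            Joins vertexMap (src (edgeAt F i))
                            and   vertexMap (tgt (edgeAt F i))

open Copy public

_FreeOf_ : ∀ {m n} → EdgeOrderedGraph n → EdgeOrderedGraph m → Set
H FreeOf F = ¬ Copy F H

insertMin : ∀ {n} (H : EdgeOrderedGraph n) (e : Edge n) → e ∉ edges H →
            EdgeOrderedGraph n
insertMin H e e∉H = graph (e ∷ edges H) (¬Any⇒All¬ (edges H) e∉H ∷ unique H)

-- The inserted edge has label zero in insertMin H e e∉H; a copy is new when it
-- uses that edge.
SemisaturatedMin : ∀ {m n} → EdgeOrderedGraph m → EdgeOrderedGraph n → Set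
SemisaturatedMin {n = n} F H =
  ∀ (e : Edge n) (e∉H : e ∉ edges H) →
  Σ[ c ∈ Copy F (insertMin H e e∉H) ] ∃[ i ] labelMap c i ≡ zero

SaturatedMin : ∀ {m n} → EdgeOrderedGraph m → EdgeOrderedGraph n → Set
SaturatedMin F H = H FreeOf F × SemisaturatedMin F H

record IsMinimumSize {n : ℕ} (P : EdgeOrderedGraph n → Set) (k : ℕ) : Set where
  field
    attained : ∃[ H ] P H × size H ≡ k
    minimal  : ∀ H → P H → k ≤ size H

Is-ssatₘ : ∀ {m} (n : ℕ) (F : EdgeOrderedGraph m) → ℕ → Set
Is-ssatₘ n F = IsMinimumSize {n} (SemisaturatedMin F)

Is-satₘ : ∀ {m} (n : ℕ) (F : EdgeOrderedGraph m) → ℕ → Set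
Is-satₘ n F = IsMinimumSize {n} (SaturatedMin F)

-- The vertices 0, 1, 2, 3 are a, b, v, w, and the edges are listed in the order
-- ab < av < aw < bw < bv.
D₀ : EdgeOrderedGraph 4
D₀ = graph (ab ∷ av ∷ aw ∷ bw ∷ bv ∷ []) distinct
  where
  ab av aw bw bv : Edge 4
  ab = edge 0F 1F (s≤s z≤n)
  av = edge 0F 2F (s≤s z≤n)
  aw = edge 0F 3F (s≤s z≤n)
  bw = edge 1F 3F (s≤s (s≤s z≤n))
  bv = edge 1F 2F (s≤s (s≤s z≤n))

  distinct : Unique (ab ∷ av ∷ aw ∷ bw ∷ bv ∷ [])
  distinct = ((λ ()) ∷ (λ ()) ∷ (λ ()) ∷ (λ ()) ∷ [])
           ∷ ((λ ()) ∷ (λ ()) ∷ (λ ()) ∷ [])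
           ∷ ((λ ()) ∷ (λ ()) ∷ [])
           ∷ ((λ ()) ∷ [])
           ∷ []
           ∷ []

module _ {m n : ℕ} where

  injectˡ : Edge m → Edge (m + n)
  injectˡ (edge u v u<v) = edge (u ↑ˡ n) (v ↑ˡ n)
    (subst₂ ℕ._<_ (sym (toℕ-↑ˡ u n)) (sym (toℕ-↑ˡ v n)) u<v)

  injectʳ : Edge n → Edge (m + n)
  injectʳ (edge u v u<v) = edge (m ↑ʳ u) (m ↑ʳ v)
    (subst₂ ℕ._<_ (sym (toℕ-↑ʳ m u)) (sym (toℕ-↑ʳ m v)) (ℕ.+-monoʳ-< m u<v))

  private
    edge-≡ : ∀ {k} {e e′ : Edge k} → src e ≡ src e′ → tgt e ≡ tgt e′ → e ≡ e′
    edge-≡ refl refl = refl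

    injectˡ-injective : Injective _≡_ _≡_ injectˡ
    injectˡ-injective eq = edge-≡ (↑ˡ-injective n _ _ (cong src eq))
                                  (↑ˡ-injective n _ _ (cong tgt eq))

    injectʳ-injective : Injective _≡_ _≡_ injectʳ
    injectʳ-injective eq = edge-≡ (↑ʳ-injective m _ _ (cong src eq))
                                  (↑ʳ-injective m _ _ (cong tgt eq))

    ↑ˡ≢↑ʳ : ∀ (u : Fin m) (v : Fin n) → ¬ u ↑ˡ n ≡ m ↑ʳ v
    ↑ˡ≢↑ʳ u v eq = ℕ.m+n≮m m (toℕ v) (subst₂ ℕ._<_
      (trans (sym (toℕ-↑ˡ u n)) (trans (cong toℕ eq) (toℕ-↑ʳ m v))) refl (toℕ<n u))

  -- The vertex-disjoint union, with every label of F below every label of G.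
  infixl 6 _⊕_
  _⊕_ : EdgeOrderedGraph m → EdgeOrderedGraph n → EdgeOrderedGraph (m + n)
  F ⊕ G = graph (map injectˡ (edges F) ++ map injectʳ (edges G))
    (Unique.++⁺ (Unique.map⁺ injectˡ-injective (unique F))
                (Unique.map⁺ injectʳ-injective (unique G))
                λ (p , q) → disjoint p q)
    where
    disjoint : ∀ {e} → _ → _ → ⊥
    disjoint {e} p q with ∈-map⁻ injectˡ {y = e} {xs = edges F} p
                        | ∈-map⁻ injectʳ {y = e} {xs = edges G} q
    ... | f , _ , e≡f | g , _ , e≡g =
      ↑ˡ≢↑ʳ (src f) (src g) (cong src (trans (sym e≡f) e≡g))

-- For n ≥ 2, ⌊log₂ n⌋ is within a factor 2 of log₂ n, and for n ≥ 4 the number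
-- ⌊log₂ ⌊log₂ n⌋⌋ is within a factor 2 of log₂ log₂ n.  Hence the asymptotic
-- classes below are those of the real logarithms (to any base).

-- f = Ω(n √(log n)): eventually n √(log n) ≤ C f(n), with both sides squared.
IsΩ[n√logn] : (ℕ → ℕ) → Set
IsΩ[n√logn] f =
  ∃[ C ] ∃[ N ] ∀ n → N ≤ n → n ^ 2 * ⌊log₂ n ⌋ ≤ (C * f n) ^ 2

-- f = O(n log n / log log n): eventually f(n) ≤ C n log n / log log n, with
-- both sides multiplied by log log n, which is positive for n ≥ 4.
IsO[nlogn/loglogn] : (ℕ → ℕ) → Set
IsO[nlogn/loglogn] f =
  ∃[ C ] ∃[ N ] ∀ n → N ≤ n → f n * ⌊log₂ ⌊log₂ n ⌋ ⌋ ≤ C * (n * ⌊log₂ n ⌋)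

{-# OPTIONS --safe #-}

-- Lower bound.  The neighbours of each vertex are ranked by the order of its
-- edges.  Choose a value f(v) ≤ d for every vertex v, and keep a vertex x of
-- degree at most d if f(v) is the rank of v at x for each neighbour v of x; on
-- average at least a (d + 1)^(-d) fraction is kept.  Two kept vertices see their
-- common neighbours in the same order, whereas a new copy of D₀ needs v before w
-- at a and w before v at b.  So the kept vertices form a clique, which has at
-- most d + 1 vertices, and n < 2 (d + 1)^(d + 1) when d is four times size / n.
--
-- Upper bound.  Join each of t ≤ q^r vertices to the same q + r hubs, in an order
-- of the hubs that encodes a word of length r over q letters, one vertex after
-- another.  Distinct words order some two hubs differently, so each edge between
-- two of the t vertices creates a new copy of D₀, while the graph is bipartite
-- and D₀ contains a triangle.  Add a copy of G on top and insert missing edges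
-- greedily: every edge of the result has an end outside the t vertices.
module Submission where

open import Defs
open import Data.Empty using (⊥; ⊥-elim-irr)
open import Data.Fin.Base as Fin
  using (Fin; zero; suc; toℕ; finToFun; funToFin; combine; remQuot; fromℕ<; _↑ˡ_; _↑ʳ_;
    splitAt; inject≤; cast)
open import Data.Fin.Patterns using (0F; 1F; 2F; 3F; 4F)
import Data.Fin.Properties as Fin
open import Data.List.Base
  using (List; []; _∷_; _++_; map; length; lookup; filter; allFin; tabulate; take;
    cartesianProduct)
open import Data.List.Membership.DecPropositional using () renaming (_∈?_ to member?)
open import Data.List.Membership.Propositional using (_∈_; _∉_)
open import Data.List.Membership.Propositional.Properties
  using (∈-lookup; ∈-filter⁺; ∈-filter⁻; ∈-allFin; ∈-map⁺; ∈-++⁺ˡ; ∈-cartesianProduct⁺)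
open import Data.List.Properties
  using (length-tabulate; filter-all; filter-some; length-map; length-++)
open import Data.List.Relation.Binary.Permutation.Propositional using (↭-sym; ↭⇒↭ₛ)
open import Data.List.Relation.Binary.Permutation.Propositional.Properties
  using (∈-resp-↭)
import Data.List.Relation.Binary.Permutation.Setoid.Properties as ↭ₛ
open import Data.List.Relation.Binary.Subset.Propositional using (_⊆_)
open import Data.List.Relation.Unary.All as All using (All; []; _∷_)
import Data.List.Relation.Unary.All.Properties as All
open import Data.List.Relation.Unary.AllPairs as AllPairs using ([]; _∷_; AllPairs)
import Data.List.Relation.Unary.AllPairs.Properties as AllPairs
open import Data.List.Relation.Unary.Any as Any using (here; there; index)
open import Data.List.Relation.Unary.Any.Properties using (lookup-index)
open import Data.List.Relation.Unary.Linked using (Linked; []; [-]; _∷_)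
open import Data.List.Relation.Unary.Linked.Properties using (Linked⇒AllPairs)
open import Data.List.Relation.Unary.Unique.DecPropositional using () renaming (unique? to unique?)
open import Data.List.Relation.Unary.Unique.Propositional using (Unique)
import Data.List.Relation.Unary.Unique.Propositional.Properties as Unique
import Data.List.Sort
open import Data.Nat.Base
  using (ℕ; zero; suc; _+_; _*_; _^_; _∸_; _≤_; _<_; z≤n; s≤s; s<s; z<s; s<s⁻¹; NonZero;
    ⌊_/2⌋; ⌈_/2⌉; >-nonZero)
open import Data.Nat.DivMod using (_/_; m≡m%n+[m/n]*n; m%n<n; m/n*n≤m; _%_)
open import Data.Nat.Induction using (<-rec)
open import Data.Nat.ListAction using (sum)
open import Data.Nat.Logarithm
  using (⌊log₂_⌋; ⌊log₂⌋-mono-≤; ⌊log₂[2^n]⌋≡n; ⌊log₂⌊n/2⌋⌋≡⌊log₂n⌋∸1)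
import Data.Nat.Properties as ℕ
open import Data.Nat.Tactic.RingSolver using (solve-∀)
open import Data.Product.Base as Prod
  using (Σ-syntax; ∃-syntax; ∃; _×_; _,_; proj₁; proj₂)
open import Data.Sum.Base as Sum using (_⊎_; inj₁; inj₂; [_,_]′)
open import Data.Sum.Properties using (inj₂-injective; inj₁-injective)
open import Data.Unit.Base using (⊤; tt)
open import Function.Base using (_∘_; id)
open import Function.Definitions using (Injective)
import Relation.Binary.Construct.On as On
open import Relation.Binary.Core using (_Preserves_⟶_)
open import Relation.Binary.Definitions using (DecidableEquality; tri<; tri≈; tri>)
open import Relation.Binary.PropositionalEquality
  using (_≡_; _≢_; _≗_; refl; sym; trans; cong; cong₂; subst; subst₂; setoid)
open import Relation.Nullary.Decidable
  using (Dec; yes; no; map′; recompute; decidable-stable; ¬?; _×-dec_; _⊎-dec_; _→-dec_)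
open import Relation.Nullary.Negation using (¬_; contradiction)
open import Relation.Unary using (Decidable)

private
  variable
    k m n : ℕ
    A B : Set

-- Copies and saturation

joins-unique : ∀ {e e′ : Edge n} {u v} → e Joins u and v → e′ Joins u and v → e ≡ e′
joins-unique (inj₁ (refl , refl)) (inj₁ (refl , refl)) = refl
joins-unique (inj₂ (refl , refl)) (inj₂ (refl , refl)) = refl
joins-unique {e = edge _ _ p} {edge _ _ q} (inj₁ (refl , refl)) (inj₂ (refl , refl)) =
  ⊥-elim-irr (Fin.<-asym p q)
joins-unique {e = edge _ _ p} {edge _ _ q} (inj₂ (refl , refl)) (inj₁ (refl , refl)) =
  ⊥-elim-irr (Fin.<-asym p q)

joins-cancelˡ : ∀ {e : Edge n} {u v w} → e Joins u and v → e Joins u and w → v ≡ w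
joins-cancelˡ (inj₁ (refl , refl)) (inj₁ (refl , refl)) = refl
joins-cancelˡ (inj₁ (refl , refl)) (inj₂ (refl , refl)) = refl
joins-cancelˡ (inj₂ (refl , refl)) (inj₁ (refl , refl)) = refl
joins-cancelˡ (inj₂ (refl , refl)) (inj₂ (refl , refl)) = refl

lookup-injective : ∀ {xs : List A} → Unique xs → Injective _≡_ _≡_ (lookup xs)
lookup-injective (_ ∷ _)  {zero}  {zero}  _  = refl
lookup-injective {xs = _ ∷ xs} (x∉ ∷ _) {zero}  {suc j} eq =
  contradiction eq (All.lookup x∉ (∈-lookup {xs = xs} j))
lookup-injective {xs = _ ∷ xs} (x∉ ∷ _) {suc i} {zero}  eq =
  contradiction (sym eq) (All.lookup x∉ (∈-lookup {xs = xs} i))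
lookup-injective (_ ∷ u)  {suc i} {suc j} eq = cong suc (lookup-injective u eq)

-- Pigeonhole: the chosen codes of the positions form an injection into `Fin m`. As `R` is a
-- relation, an element may have several codes, and the choice may depend on the membership proof.
unique⇒length≤ : ∀ {xs : List A} (R : A → Fin m → Set) → Unique xs →
                 (∀ {x} → x ∈ xs → ∃ (R x)) → (∀ {x y i} → R x i → R y i → x ≡ y) →
                 length xs ≤ m
unique⇒length≤ {xs = xs} R u code R-inj = Fin.injective⇒≤ {f = λ i → proj₁ (code (∈-lookup {xs = xs} i))}
  λ {i} {j} eq → lookup-injective u
    (R-inj (subst (R (lookup xs i)) eq (proj₂ (code (∈-lookup i)))) (proj₂ (code (∈-lookup j))))

-- Decidability by finite search.

joins? : ∀ (e : Edge n) u v → Dec (e Joins u and v)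
joins? e u v = (src e Fin.≟ u ×-dec tgt e Fin.≟ v) ⊎-dec (src e Fin.≟ v ×-dec tgt e Fin.≟ u)

infix 4 _≟ᵉ_
_≟ᵉ_ : DecidableEquality (Edge n)
edge u v _ ≟ᵉ edge u′ v′ _ =
  map′ (λ { (refl , refl) → refl }) (λ { refl → refl , refl }) (u Fin.≟ u′ ×-dec v Fin.≟ v′)

anyEdge? : {P : Edge n → Set} → Decidable P → Dec (∃ P)
anyEdge? {P = P} P? = map′ (λ (u , v , u<v , p) → edge u v u<v , p)
    -- The order of the ends is stored irrelevantly, so a relevant proof is recomputed from its
    -- decision.
    (λ { (edge u v u<v , p) → u , v , recompute (u Fin.<? v) u<v , p })
    (Fin.any? λ u → Fin.any? λ v → edge? u v)
  where
  edge? : ∀ u v → Dec (Σ[ u<v ∈ u Fin.< v ] P (edge u v u<v))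
  edge? u v with u Fin.<? v
  ... | yes u<v = map′ (u<v ,_) proj₂ (P? (edge u v u<v))
  ... | no  u≮v = no λ (u<v , _) → u≮v u<v

allEdges? : {P : Edge n → Set} → Decidable P → Dec (∀ e → P e)
allEdges? P? = map′ (λ ¬∃ e → decidable-stable (P? e) λ ¬p → ¬∃ (e , ¬p))
                    (λ ∀P (e , ¬p) → ¬p (∀P e))
                    (¬? (anyEdge? (¬? ∘ P?)))

anyList? : (∀ {P : A → Set} → Decidable P → Dec (∃ P)) →
           ∀ k {Q : List A → Set} → Decidable Q → Dec (∃[ xs ] length xs ≡ k × Q xs)
anyList? any? zero    Q? = map′ (λ q → [] , refl , q) (λ { ([] , refl , q) → q }) (Q? [])
anyList? any? (suc k) Q? =
  map′ (λ (x , xs , eq , q) → x ∷ xs , cong suc eq , q)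
       (λ { (x ∷ xs , eq , q) → x , xs , ℕ.suc-injective eq , q })
       (any? λ x → anyList? any? k (Q? ∘ (x ∷_)))

-- The functions are enumerated by the numbers below `n ^ m`. Decoding returns a function only up to
-- pointwise equality, hence the condition that `P` respects it.
anyFunction? : {P : (Fin m → Fin n) → Set} → (∀ {f g} → f ≗ g → P f → P g) →
               Decidable P → Dec (∃ P)
anyFunction? resp P? = map′ (λ (x , p) → finToFun x , p)
  (λ (f , p) → funToFin f , resp (sym ∘ Fin.finToFun-funToFin f) p)
  (Fin.any? (P? ∘ finToFun))

anyGraph? : {P : EdgeOrderedGraph n → Set} → Decidable P → ∀ k → Dec (∃[ H ] P H × size H ≡ k)
anyGraph? {P = P} P? k =
  map′ (λ (es , eq , u , p) → graph es u , p , eq)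
       (λ { (graph es u , p , eq) → es , eq , u , p })
       (anyList? anyEdge? k graph?)
  where
  graph? : ∀ es → Dec (Σ[ u ∈ Unique es ] P (graph es u))
  graph? es with unique? _≟ᵉ_ es
  ... | no ¬u = no (¬u ∘ proj₁)
  ... | yes u = map′ (u ,_)
      -- Two proofs of `Unique es` are equal, so testing `P` with one of them settles it for all.
      (λ (u′ , p) → subst (P ∘ graph es) (AllPairs.irrelevant (λ _ _ → refl) u′ u) p)
      (P? (graph es u))

-- Well-founded descent on the size: there are finitely many graphs of each size, so it is decidable
-- whether `P` holds at a smaller one.
minimumSize : {P : EdgeOrderedGraph n → Set} → Decidable P → ∃ P → ∃ (IsMinimumSize P)
minimumSize {n} {P} P? (H , PH) = <-rec Goal step (size H) (H , PH , refl)
  where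
  OfSize Goal : ℕ → Set
  OfSize k = ∃[ H ] P H × size H ≡ k
  Goal   k = OfSize k → ∃ (IsMinimumSize P)

  step : ∀ k → (∀ {j} → j < k → Goal j) → Goal k
  step k rec H-of-size-k with ℕ.anyUpTo? (anyGraph? P?) k
  ... | yes (j , j<k , H-of-size-j) = rec j<k H-of-size-j
  ... | no  none = k , record
    { attained = H-of-size-k
    ; minimal  = λ H PH → ℕ.≮⇒≥ λ H<k → none (size H , H<k , H , PH , refl)
    }

-- The laws of `Copy` split off from its two maps, so that copies can be found by running through
-- all pairs of maps.
IsCopy : (F : EdgeOrderedGraph m) (H : EdgeOrderedGraph n) →
         (Fin m → Fin n) → (Label F → Label H) → Set
IsCopy F H φ ℓ =
    (∀ x y → φ x ≡ φ y → x ≡ y)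
  × (∀ i j → i Fin.< j → ℓ i Fin.< ℓ j)
  × (∀ i → edgeAt H (ℓ i) Joins φ (src (edgeAt F i)) and φ (tgt (edgeAt F i)))

isCopy-resp : ∀ {F : EdgeOrderedGraph m} {H : EdgeOrderedGraph n} {φ φ′ ℓ ℓ′} →
              φ ≗ φ′ → ℓ ≗ ℓ′ → IsCopy F H φ ℓ → IsCopy F H φ′ ℓ′
isCopy-resp {F = F} {H} {φ} {φ′} φ≗ ℓ≗ (inj , mono , inc) =
    (λ x y eq → inj x y (trans (φ≗ x) (trans eq (sym (φ≗ y)))))
  , (λ i j i<j → subst₂ Fin._<_ (ℓ≗ i) (ℓ≗ j) (mono i j i<j))
  , λ i → subst₂ (edgeAt H _ Joins_and_) (φ≗ _) (φ≗ _)
      (subst (λ l → edgeAt H l Joins φ (src (edgeAt F i)) and φ (tgt (edgeAt F i))) (ℓ≗ i) (inc i))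

isCopy? : ∀ (F : EdgeOrderedGraph m) (H : EdgeOrderedGraph n) φ ℓ → Dec (IsCopy F H φ ℓ)
isCopy? F H φ ℓ =
        Fin.all? (λ x → Fin.all? λ y → (φ x Fin.≟ φ y) →-dec (x Fin.≟ y))
  ×-dec Fin.all? (λ i → Fin.all? λ j → (i Fin.<? j) →-dec (ℓ i Fin.<? ℓ j))
  ×-dec Fin.all? (λ i → joins? (edgeAt H (ℓ i)) _ _)

copyWith? : ∀ (F : EdgeOrderedGraph m) (H : EdgeOrderedGraph n) {Q : (Label F → Label H) → Set} →
            (∀ {ℓ ℓ′} → ℓ ≗ ℓ′ → Q ℓ → Q ℓ′) → Decidable Q → Dec (Σ[ c ∈ Copy F H ] Q (labelMap c))
copyWith? F H resp Q? =
  map′ (λ (φ , ℓ , (inj , mono , inc) , q) →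
          record { vertexMap = φ ; vertexMap-injective = inj _ _
                 ; labelMap = ℓ ; labelMap-mono = mono _ _ ; incident = inc } , q)
       (λ (c , q) → vertexMap c , labelMap c ,
          ((λ _ _ → vertexMap-injective c) , (λ _ _ → labelMap-mono c) , incident c) , q)
       (anyFunction? (λ φ≗ (ℓ , ok , q) → ℓ , isCopy-resp {F = F} {H} φ≗ (λ _ → refl) ok , q) λ φ →
        anyFunction? (λ ℓ≗ (ok , q) → isCopy-resp {F = F} {H} (λ _ → refl) ℓ≗ ok , resp ℓ≗ q) λ ℓ →
        isCopy? F H φ ℓ ×-dec Q? ℓ)

freeOf? : ∀ (F : EdgeOrderedGraph m) (H : EdgeOrderedGraph n) → Dec (H FreeOf F)
freeOf? F H = ¬? (map′ proj₁ (_, tt) (copyWith? F H {λ _ → ⊤} (λ _ _ → tt) (λ _ → yes tt)))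

NewCopy : (F : EdgeOrderedGraph m) (H : EdgeOrderedGraph n) (e : Edge n) → e ∉ edges H → Set
NewCopy F H e e∉H = Σ[ c ∈ Copy F (insertMin H e e∉H) ] ∃[ i ] labelMap c i ≡ zero

newCopy? : ∀ (F : EdgeOrderedGraph m) (H : EdgeOrderedGraph n) e (e∉H : e ∉ edges H) →
           Dec (NewCopy F H e e∉H)
newCopy? F H e e∉H = copyWith? F (insertMin H e e∉H)
  (λ ℓ≗ (i , eq) → i , trans (sym (ℓ≗ i)) eq) λ ℓ → Fin.any? λ i → ℓ i Fin.≟ zero

semisaturatedMin? : ∀ (F : EdgeOrderedGraph m) (H : EdgeOrderedGraph n) → Dec (SemisaturatedMin F H)
semisaturatedMin? F H = allEdges? λ e → edge? e (member? _≟ᵉ_ e (edges H))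
  where
  edge? : ∀ e → Dec (e ∈ edges H) → Dec (∀ e∉H → NewCopy F H e e∉H)
  edge? e (yes e∈H) = yes λ e∉H → contradiction e∈H e∉H
  edge? e (no  e∉H) = map′ {A = NewCopy F H e e∉H} (λ c _ → c) (λ f → f e∉H) (newCopy? F H e e∉H)

saturatedMin? : ∀ (F : EdgeOrderedGraph m) (H : EdgeOrderedGraph n) → Dec (SaturatedMin F H)
saturatedMin? F H = freeOf? F H ×-dec semisaturatedMin? F H

-- Insertion of least edges and greedy saturation.

mapCopy : ∀ {F : EdgeOrderedGraph m} {H K : EdgeOrderedGraph n} (g : Label H → Label K) →
          g Preserves Fin._<_ ⟶ Fin._<_ → (∀ i → edgeAt K (g i) ≡ edgeAt H i) →
          Copy F H → Copy F K
mapCopy {F = F} g g-mono g-edge c = record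
  { vertexMap           = vertexMap c
  ; vertexMap-injective = vertexMap-injective c
  ; labelMap            = g ∘ labelMap c
  ; labelMap-mono       = g-mono ∘ labelMap-mono c
  ; incident            = λ i → subst (_Joins vertexMap c (src (edgeAt F i)) and vertexMap c (tgt (edgeAt F i)))
                                      (sym (g-edge (labelMap c i))) (incident c i)
  }

-- `e` comes first in both graphs, and `e′`, second in the larger one, is left out by the copy. All
-- other edges keep their order.
newCopy-insertMin : ∀ {F : EdgeOrderedGraph m} {H : EdgeOrderedGraph n} {e e′} e′∉H e∉H e∉K →
                    NewCopy F H e e∉H → NewCopy F (insertMin H e′ e′∉H) e e∉K
newCopy-insertMin {H = H} {e} {e′} e′∉H e∉H e∉K (c , i , eq) =
  mapCopy skip skip-mono skip-edge c , i , cong skip eq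
  where
  skip : Label (insertMin H e e∉H) → Label (insertMin (insertMin H e′ e′∉H) e e∉K)
  skip zero    = zero
  skip (suc i) = suc (suc i)

  skip-mono : skip Preserves Fin._<_ ⟶ Fin._<_
  skip-mono {zero}  {suc j} _         = z<s
  skip-mono {suc i} {suc j} (s<s i<j) = s<s (s<s i<j)

  skip-edge : ∀ i → edgeAt (insertMin (insertMin H e′ e′∉H) e e∉K) (skip i)
                  ≡ edgeAt (insertMin H e e∉H) i
  skip-edge zero    = refl
  skip-edge (suc i) = refl

-- A copy that avoids label zero has only successor labels and thus lies in `H`; one that uses zero
-- is new.
insertMin-free : ∀ {F : EdgeOrderedGraph m} {H : EdgeOrderedGraph n} {e} e∉H →
                 H FreeOf F → ¬ NewCopy F H e e∉H → insertMin H e e∉H FreeOf F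
insertMin-free {F = F} {H} {e} e∉H free ¬new c with Fin.any? (λ i → labelMap c i Fin.≟ zero)
... | yes (i , eq) = ¬new (c , i , eq)
... | no  none     = free record
  { vertexMap           = vertexMap c
  ; vertexMap-injective = vertexMap-injective c
  ; labelMap            = proj₁ ∘ pred
  ; labelMap-mono       = λ {i} {j} i<j → s<s⁻¹
      (subst₂ Fin._<_ (proj₂ (pred i)) (proj₂ (pred j)) (labelMap-mono c i<j))
  ; incident            = λ i → subst
      (λ l → edgeAt (insertMin H e e∉H) l Joins vertexMap c (src (edgeAt F i)) and vertexMap c (tgt (edgeAt F i)))
      (proj₂ (pred i)) (incident c i)
  }
  where
  pred : ∀ i → ∃[ l ] labelMap c i ≡ suc l
  pred i with labelMap c i in eq
  ... | zero  = contradiction (i , eq) none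
  ... | suc l = l , refl

-- p packs an end of e that enc sends to Fin m together with the other end, so it
-- determines e.
Coded : {T : Set} → (Fin n → T ⊎ Fin m) → Edge n → Fin (m * n) → Set
Coded {n = n} {m} enc e p =
  ∃[ z ] e Joins z and proj₂ (remQuot {m} n p) × enc z ≡ inj₂ (proj₁ (remQuot {m} n p))

coded : ∀ {T : Set} (enc : Fin n → T ⊎ Fin m) {e u v x} →
        e Joins u and v → enc u ≡ inj₂ x → ∃ (Coded enc e)
coded {n} {m} enc {e} {u} {v} {x} e-joins eq = combine x v , u ,
  subst (e Joins u and_) (sym (cong proj₂ (Fin.remQuot-combine {m} {n} x v))) e-joins ,
  trans eq (cong inj₂ (sym (cong proj₁ (Fin.remQuot-combine {m} {n} x v))))

-- At most `m` vertices are sent to the right by the injective `enc`, and each of them has at most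
-- `n` possible second ends.
size≤ : ∀ {T : Set} (enc : Fin n → T ⊎ Fin m) → Injective _≡_ _≡_ enc →
        (H : EdgeOrderedGraph n) → All (∃ ∘ Coded enc) (edges H) → size H ≤ m * n
size≤ enc enc-inj H all = unique⇒length≤ (Coded enc) (unique H) (All.lookup all)
  λ { (z , j , eq) (z′ , j′ , eq′) → inj j eq j′ eq′ }
  where
  inj : ∀ {e e′ z z′ v x} → e Joins z and v → enc z ≡ inj₂ x → e′ Joins z′ and v → enc z′ ≡ inj₂ x → e ≡ e′
  inj j eq j′ eq′ with refl ← enc-inj (trans eq (sym eq′)) = joins-unique j j′

size≤n*n : ∀ (H : EdgeOrderedGraph n) → size H ≤ n * n
size≤n*n H = size≤ {T = ⊥} inj₂ inj₂-injective H
  (All.tabulate λ {e} _ → coded inj₂ {e = e} (inj₁ (refl , refl)) refl)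

-- An edge whose insertion creates a new copy still does so after edges are inserted
-- below, so the greedy process only ever inserts edges satisfying B.
saturate : ∀ {F : EdgeOrderedGraph m} {B : Edge n → Set} (H : EdgeOrderedGraph n) →
           H FreeOf F → All B (edges H) →
           (∀ e → B e ⊎ (∀ e∉H → NewCopy F H e e∉H)) →
           ∃[ K ] SaturatedMin F K × All B (edges K)
saturate {n = n} {F} {B} H = go (n * n) H (ℕ.m≤m+n _ _)
  where
  go : ∀ fuel (H : EdgeOrderedGraph n) → n * n ≤ fuel + size H →
       H FreeOf F → All B (edges H) → (∀ e → B e ⊎ (∀ e∉H → NewCopy F H e e∉H)) →
       ∃[ K ] SaturatedMin F K × All B (edges K)
  go fuel H room free allB split with anyEdge? addable?
    where
    addable? : Decidable (λ e → Σ[ e∉H ∈ e ∉ edges H ] ¬ NewCopy F H e e∉H)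
    addable? e with member? _≟ᵉ_ e (edges H)
    ... | yes e∈H = no λ (e∉H , _) → e∉H e∈H
    ... | no  e∉H = map′ (e∉H ,_) proj₂ (¬? (newCopy? F H e e∉H))
  ... | no none = H , (free , λ e e∉H → decidable-stable (newCopy? F H e e∉H)
                                          λ ¬new → none (e , e∉H , ¬new)) , allB
  -- Without fuel `size H` is already at least `n * n`, and one more edge would exceed the bound on
  -- every size.
  go zero H room _ _ _ | yes (e , e∉H , _) =
    contradiction (ℕ.≤-trans (size≤n*n (insertMin H e e∉H)) room) ℕ.1+n≰n
  go (suc fuel) H room free allB split | yes (e , e∉H , ¬new) =
    go fuel (insertMin H e e∉H) (ℕ.≤-trans room (ℕ.≤-reflexive (sym (ℕ.+-suc fuel (size H)))))
       (insertMin-free {F = F} e∉H free ¬new)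
       ([ id , (λ new → contradiction (new e∉H) ¬new) ]′ (split e) ∷ allB)
       λ e′ → Sum.map₂ (λ new e′∉K → newCopy-insertMin {F = F} e∉H (e′∉K ∘ there) e′∉K (new (e′∉K ∘ there)))
                       (split e′)

-- Existence of the two minima.

module _ (F : EdgeOrderedGraph m) (n : ℕ) (1≤F : 1 ≤ size F) where

  private
    saturated : ∃[ H ] SaturatedMin {n = n} F H
    -- The greedy process starts from the edgeless graph, which is free of `F` because `F` has an
    -- edge.
    saturated with saturate {F = F} {B = λ _ → ⊤} (graph [] []) (λ c → empty 1≤F (labelMap c)) [] (λ _ → inj₁ tt)
      where
      empty : ∀ {m} → 1 ≤ m → (Fin m → Fin 0) → ⊥
      empty (s≤s _) f with () ← f zero
    ... | K , sat , _ = K , sat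

  ssat-exists : ∃ (Is-ssatₘ n F)
  ssat-exists = minimumSize (semisaturatedMin? F) (proj₁ saturated , proj₂ (proj₂ saturated))

  sat-exists : ∃ (Is-satₘ n F)
  sat-exists = minimumSize (saturatedMin? F) saturated

-- The lower bound

∑ : List A → (A → ℕ) → ℕ
∑ xs w = sum (map w xs)

∑-const : ∀ (xs : List A) c → ∑ xs (λ _ → c) ≡ length xs * c
∑-const []       c = refl
∑-const (x ∷ xs) c = cong (c +_) (∑-const xs c)

length*≤∑* : ∀ {xs : List A} {w : A → ℕ} {c d} → (∀ {x} → x ∈ xs → c ≤ w x * d) →
             length xs * c ≤ ∑ xs w * d
length*≤∑* {xs = []}                 c≤ = z≤n
length*≤∑* {xs = x ∷ xs} {w} {c} {d} c≤ = begin
  c + length xs * c      ≤⟨ ℕ.+-mono-≤ (c≤ (here refl)) (length*≤∑* (c≤ ∘ there)) ⟩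
  w x * d + ∑ xs w * d   ≡⟨ ℕ.*-distribʳ-+ d (w x) (∑ xs w) ⟨
  (w x + ∑ xs w) * d     ∎
  where open ℕ.≤-Reasoning

-- Double counting of the pairs `(i , x)` with `R i x`, each counted with weight `w x`.
∑-filter-swap : ∀ {R : A → B → Set} (R? : ∀ i x → Dec (R i x)) (w : B → ℕ) is xs →
                ∑ is (λ i → ∑ (filter (R? i) xs) w)
              ≡ ∑ xs (λ x → length (filter (λ i → R? i x) is) * w x)
∑-filter-swap R? w []       xs = sym (trans (∑-const xs 0) (ℕ.*-zeroʳ (length xs)))
∑-filter-swap R? w (i ∷ is) xs =
  trans (cong (∑ (filter (R? i) xs) w +_) (∑-filter-swap R? w is xs)) (column xs)
  where
  column : ∀ xs → ∑ (filter (R? i) xs) w + ∑ xs (λ x → length (filter (λ i → R? i x) is) * w x)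
                ≡ ∑ xs (λ x → length (filter (λ i → R? i x) (i ∷ is)) * w x)
  column [] = refl
  column (x ∷ xs) with R? i x
  ... | yes _ = trans (rearrange (w x) _ _ _) (cong (w x + _ +_) (column xs))
    where
    rearrange : ∀ a b c d → a + b + (c + d) ≡ a + c + (b + d)
    rearrange = solve-∀
  ... | no  _ = trans (rearrange (∑ (filter (R? i) xs) w) (length (filter (λ i → R? i x) is) * w x) _)
                      (cong (length (filter (λ i → R? i x) is) * w x +_) (column xs))
    where
    rearrange : ∀ b c d → b + (c + d) ≡ c + (b + d)
    rearrange = solve-∀

-- A largest term is at least the average.
∑≤length*term : ∀ (g : A → ℕ) i is → ∃[ j ] ∑ (i ∷ is) g ≤ length (i ∷ is) * g j
∑≤length*term g i []        = i , ℕ.≤-refl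
∑≤length*term g i (i′ ∷ is) with ∑≤length*term g i′ is
... | j , avg with ℕ.≤-total (g i) (g j)
...   | inj₁ gi≤gj = j , ℕ.+-mono-≤ gi≤gj avg
...   | inj₂ gj≤gi = i , ℕ.+-monoʳ-≤ (g i) (ℕ.≤-trans avg (ℕ.*-monoʳ-≤ (length (i′ ∷ is)) gj≤gi))

-- For each v a value in Fin (suc d) is chosen, and the x that do not fit a
-- chosen value are discarded.  The weight of x counts the ways to choose all
-- values so that x survives, so by averaging some choice keeps the mean number.
module _ {X V : Set} {d : ℕ} {Fits : V → Fin (suc d) → X → Set}
         (fits? : ∀ v i x → Dec (Fits v i x)) where

  choices : V → X → ℕ
  choices v x = length (filter (λ i → fits? v i x) (allFin (suc d)))

  weight : List V → X → ℕ
  weight []       x = 1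
  weight (v ∷ vs) x = choices v x * weight vs x

  -- The method of conditional expectations: the values are fixed one vertex at a time, each so that
  -- the remaining weight is at least its average over the `suc d` values. At the end every survivor
  -- has weight 1.
  survivors : ∀ vs xs → ∃[ ys ] ∑ xs (weight vs) ≤ length ys * suc d ^ length vs
                              × ys ⊆ xs × (Unique xs → Unique ys)
                              × (∀ {v} → v ∈ vs → ∃[ i ] ∀ {y} → y ∈ ys → Fits v i y)
  survivors []       xs = xs , ℕ.≤-reflexive (∑-const xs 1) , id , id , λ ()
  survivors (v ∷ vs) xs with ∑≤length*term (λ i → ∑ (filter (fits? v i) xs) (weight vs)) zero (tabulate suc)
  ... | i , avg with survivors vs (filter (fits? v i) xs)
  ...   | ys , many , ys⊆ , ys! , fit =
      ys , bound , proj₁ ∘ ∈-filter⁻ (fits? v i) ∘ ys⊆ , ys! ∘ Unique.filter⁺ (fits? v i) ,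
      λ { (here refl) → i , λ y∈ → proj₂ (∈-filter⁻ (fits? v i) {xs = xs} (ys⊆ y∈))
        ; (there v∈)  → fit v∈ }
    where
    open ℕ.≤-Reasoning
    bound : ∑ xs (weight (v ∷ vs)) ≤ length ys * (suc d * suc d ^ length vs)
    bound = begin
      ∑ xs (weight (v ∷ vs))
        ≡⟨ ∑-filter-swap (fits? v) (weight vs) (allFin (suc d)) xs ⟨
      ∑ (allFin (suc d)) (λ i → ∑ (filter (fits? v i) xs) (weight vs))
        ≤⟨ avg ⟩
      length (allFin (suc d)) * ∑ (filter (fits? v i) xs) (weight vs)
        ≡⟨ cong (_* ∑ (filter (fits? v i) xs) (weight vs)) (length-tabulate {n = suc d} id) ⟩
      suc d * ∑ (filter (fits? v i) xs) (weight vs)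
        ≤⟨ ℕ.*-monoʳ-≤ (suc d) many ⟩
      suc d * (length ys * suc d ^ length vs)
        ≡⟨ rearrange (suc d) (length ys) _ ⟩
      length ys * (suc d * suc d ^ length vs) ∎
      where
      rearrange : ∀ a b c → a * (b * c) ≡ b * (a * c)
      rearrange = solve-∀

  -- A constraining vertex leaves `x` at least one of the `suc d` values and any other vertex leaves
  -- it all of them. The lost factors stand on the right, which avoids subtraction in the exponent.
  weight-bound : ∀ {Constrains : V → Set} (constrains? : Decidable Constrains) {x} →
                 (∀ {v} → Constrains v → ∃[ i ] Fits v i x) →
                 (∀ {v} → ¬ Constrains v → ∀ i → Fits v i x) →
                 ∀ vs → suc d ^ length vs ≤ weight vs x * suc d ^ length (filter constrains? vs)
  weight-bound constrains? some all [] = ℕ.≤-refl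
  weight-bound constrains? {x} some all (v ∷ vs) with constrains? v
  ... | yes c = begin
    suc d * suc d ^ length vs
      ≤⟨ ℕ.*-monoʳ-≤ (suc d) (weight-bound constrains? some all vs) ⟩
    suc d * (weight vs x * suc d ^ r)
      ≡⟨ rearrange (suc d) (weight vs x) _ ⟩
    1 * weight vs x * (suc d * suc d ^ r)
      ≤⟨ ℕ.*-monoˡ-≤ (suc d ^ suc r) (ℕ.*-monoˡ-≤ (weight vs x)
           (filter-some (λ i → fits? v i x)
             (Any.map (λ { refl → proj₂ (some c) }) (∈-allFin (proj₁ (some c)))))) ⟩
    choices v x * weight vs x * (suc d * suc d ^ r) ∎
    where
    open ℕ.≤-Reasoning
    r = length (filter constrains? vs)
    rearrange : ∀ a b c → a * (b * c) ≡ 1 * b * (a * c)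
    rearrange = solve-∀
  ... | no ¬c = begin
    suc d * suc d ^ length vs
      ≤⟨ ℕ.*-monoʳ-≤ (suc d) (weight-bound constrains? some all vs) ⟩
    suc d * (weight vs x * suc d ^ r)
      ≡⟨ ℕ.*-assoc (suc d) (weight vs x) _ ⟨
    suc d * weight vs x * suc d ^ r
      ≡⟨ cong (λ c → c * weight vs x * suc d ^ r) (sym choices≡) ⟩
    choices v x * weight vs x * suc d ^ r ∎
    where
    open ℕ.≤-Reasoning
    r = length (filter constrains? vs)
    choices≡ : choices v x ≡ suc d
    choices≡ = trans (cong length (filter-all (λ i → fits? v i x) (All.tabulate λ {i} _ → all ¬c i)))
                     (length-tabulate {n = suc d} id)

-- Degrees and ranks.

Incident : Fin n → Edge n → Set
Incident x e = src e ≡ x ⊎ tgt e ≡ x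

-- Opaque, so that the test stays intact inside `deg` and a case split on it simplifies `deg` and
-- `rank`.
abstract
  incident? : ∀ (x : Fin n) e → Dec (Incident x e)
  incident? x e = (src e Fin.≟ x) ⊎-dec (tgt e Fin.≟ x)

joins⇒incident : ∀ (e : Edge n) {u v} → e Joins u and v → Incident u e
joins⇒incident _ = Sum.map proj₁ proj₂

deg : Fin n → List (Edge n) → ℕ
deg x es = length (filter (incident? x) es)

-- For an edge at `x` this is its place, counted from 0, among the edges at `x`.
rank : Fin n → (es : List (Edge n)) → Fin (length es) → ℕ
rank x es i = deg x (take (toℕ i) es)

rank-mono-< : ∀ {x : Fin n} es {i j} → Incident x (lookup es i) → i Fin.< j →
              rank x es i < rank x es j
rank-mono-< {x = x} (e ∷ es) {zero} {suc j} inc _ with incident? x e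
... | yes _  = z<s
... | no ¬inc = contradiction inc ¬inc
rank-mono-< {x = x} (e ∷ es) {suc i} {suc j} inc (s<s i<j) with incident? x e
... | yes _ = s<s (rank-mono-< es inc i<j)
... | no  _ = rank-mono-< es inc i<j

rank<deg : ∀ {x : Fin n} es {i} → Incident x (lookup es i) → rank x es i < deg x es
rank<deg {x = x} (e ∷ es) {zero} inc with incident? x e
... | yes _  = z<s
... | no ¬inc = contradiction inc ¬inc
rank<deg {x = x} (e ∷ es) {suc i} inc with incident? x e
... | yes _ = s<s (rank<deg es inc)
... | no  _ = rank<deg es inc

-- An edge at `x` has only one other end, so distinct neighbours occupy distinct places among the
-- edges at `x`.
neighbours≤deg : ∀ {x : Fin n} {zs} es → Unique zs →
                 (∀ {z} → z ∈ zs → ∃[ e ] e ∈ es × e Joins x and z) → length zs ≤ deg x es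
neighbours≤deg {x = x} es zs! nbr = unique⇒length≤
  (λ z i → lookup (filter (incident? x) es) i Joins x and z) zs!
  (λ z∈ → let e , e∈ , j = nbr z∈
              e∈′        = ∈-filter⁺ (incident? x) e∈ (joins⇒incident e j)
          in index e∈′ , subst (_Joins x and _) (lookup-index e∈′) j)
  (λ {_} {_} {i} → joins-cancelˡ {e = lookup (filter (incident? x) es) i})

-- Handshaking: incidences are double counted, and an edge has at most two ends.
∑deg≤ : ∀ (es : List (Edge n)) → ∑ (allFin n) (λ x → deg x es) ≤ length es * 2
∑deg≤ {n} es = begin
  ∑ (allFin n) (λ x → deg x es)
    ≡⟨ ∑-cong (allFin n) (λ x → trans (sym (ℕ.*-identityʳ _)) (sym (∑-const (filter (incident? x) es) 1))) ⟩
  ∑ (allFin n) (λ x → ∑ (filter (incident? x) es) (λ _ → 1))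
    ≡⟨ ∑-filter-swap incident? (λ _ → 1) (allFin n) es ⟩
  ∑ es (λ e → length (filter (λ x → incident? x e) (allFin n)) * 1)
    ≤⟨ ∑-mono es (λ e → ℕ.≤-trans (ℕ.≤-reflexive (ℕ.*-identityʳ _)) (ends≤2 e)) ⟩
  ∑ es (λ _ → 2)
    ≡⟨ ∑-const es 2 ⟩
  length es * 2 ∎
  where
  open ℕ.≤-Reasoning

  ∑-cong : ∀ (xs : List A) {f g} → f ≗ g → ∑ xs f ≡ ∑ xs g
  ∑-cong []       f≗g = refl
  ∑-cong (x ∷ xs) f≗g = cong₂ _+_ (f≗g x) (∑-cong xs f≗g)

  ∑-mono : ∀ (xs : List A) {f g} → (∀ x → f x ≤ g x) → ∑ xs f ≤ ∑ xs g
  ∑-mono []       f≤g = z≤n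
  ∑-mono (x ∷ xs) f≤g = ℕ.+-mono-≤ (f≤g x) (∑-mono xs f≤g)

  IsEnd : Edge n → Fin n → Fin 2 → Set
  IsEnd e x zero    = src e ≡ x
  IsEnd e x (suc _) = tgt e ≡ x

  isEnd-injective : ∀ {e x y} i → IsEnd e x i → IsEnd e y i → x ≡ y
  isEnd-injective zero    refl refl = refl
  isEnd-injective (suc _) refl refl = refl

  ends≤2 : ∀ e → length (filter (λ x → incident? x e) (allFin n)) ≤ 2
  ends≤2 e = unique⇒length≤ (IsEnd e) (Unique.filter⁺ (λ x → incident? x e) (Unique.allFin⁺ n))
    (λ x∈ → [ 0F ,_ , 1F ,_ ]′ (proj₂ (∈-filter⁻ (λ x → incident? x e) {xs = allFin n} x∈)))
    (λ {_} {_} {i} → isEnd-injective {e} i)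

-- Markov's inequality without division: each element that is not light adds at least `suc d` to the
-- sum.
markov : ∀ {Light : A → Set} (light? : Decidable Light) (w : A → ℕ) d →
         (∀ {x} → ¬ Light x → d < w x) → ∀ xs →
         length xs * suc d ≤ ∑ xs w + length (filter light? xs) * suc d
markov light? w d heavy [] = z≤n
markov light? w d heavy (x ∷ xs) with light? x
... | yes _ = ℕ.≤-trans (ℕ.+-monoʳ-≤ (suc d) (markov light? w d heavy xs))
                (ℕ.≤-trans (ℕ.m≤n+m _ (w x)) (ℕ.≤-reflexive (rearrange (w x) (suc d) (∑ xs w) _)))
  where
  rearrange : ∀ a b c e → a + (b + (c + e)) ≡ a + c + (b + e)
  rearrange = solve-∀
... | no ¬light = ℕ.≤-trans (ℕ.+-mono-≤ (heavy ¬light) (markov light? w d heavy xs))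
                 (ℕ.≤-reflexive (sym (ℕ.+-assoc (w x) _ _)))

-- Separated pairs and the number of light vertices.

edgeBetween : ∀ {u v : Fin n} → u ≢ v → ∃[ e ] e Joins u and v
edgeBetween {u = u} {v} u≢v with Fin.<-cmp u v
... | tri< u<v _ _ = edge u v u<v , inj₁ (refl , refl)
... | tri≈ _ u≡v _ = contradiction u≡v u≢v
... | tri> _ _ v<u = edge v u v<u , inj₂ (refl , refl)

joins-transport : ∀ (P : Fin n → Set) (e : Edge n) {u v u′ v′} →
                  e Joins u and v → e Joins u′ and v′ → P u → P v → P u′ × P v′
joins-transport P _ (inj₁ (refl , refl)) (inj₁ (refl , refl)) pu pv = pu , pv
joins-transport P _ (inj₁ (refl , refl)) (inj₂ (refl , refl)) pu pv = pv , pu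
joins-transport P _ (inj₂ (refl , refl)) (inj₁ (refl , refl)) pu pv = pv , pu
joins-transport P _ (inj₂ (refl , refl)) (inj₂ (refl , refl)) pu pv = pu , pv

-- H contains D₀ minus its least edge ab.
record Separated (H : EdgeOrderedGraph n) (a b : Fin n) : Set where
  field
    {v w}           : Fin n
    {av aw bw bv}   : Label H
    av<aw           : av Fin.< aw
    aw<bw           : aw Fin.< bw
    bw<bv           : bw Fin.< bv
    joins-av        : edgeAt H av Joins a and v
    joins-aw        : edgeAt H aw Joins a and w
    joins-bw        : edgeAt H bw Joins b and w
    joins-bv        : edgeAt H bv Joins b and v

-- A monotone label map that reaches zero does so at the least edge of `D₀ ⊕ G`. So the added edge
-- plays `ab`, and the other four edges of `D₀` are edges of `H`.
newCopy⇒separated : ∀ {G : EdgeOrderedGraph k} {H : EdgeOrderedGraph n} {e} e∉H →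
                    NewCopy (D₀ ⊕ G) H e e∉H → ∃[ a ] ∃[ b ] e Joins a and b × Separated H a b
newCopy⇒separated {G = G} {H} {e} e∉H (c , i , eq) =
  φ 0F , φ 1F ,
  subst (λ l → edgeAt K l Joins φ 0F and φ 1F) ab-first (incident c 0F) ,
  record
    { av<aw = below 0F 1F (s<s z<s)
    ; aw<bw = below 1F 2F (s<s (s<s z<s))
    ; bw<bv = below 2F 3F (s<s (s<s (s<s z<s)))
    ; joins-av = subst (λ l → edgeAt K l Joins φ 0F and φ 2F) (proj₂ (old 0F)) (incident c 1F)
    ; joins-aw = subst (λ l → edgeAt K l Joins φ 0F and φ 3F) (proj₂ (old 1F)) (incident c 2F)
    ; joins-bw = subst (λ l → edgeAt K l Joins φ 1F and φ 3F) (proj₂ (old 2F)) (incident c 3F)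
    ; joins-bv = subst (λ l → edgeAt K l Joins φ 1F and φ 2F) (proj₂ (old 3F)) (incident c 4F)
    }
  where
  K = insertMin H e e∉H
  φ : Fin 4 → Fin _
  φ x = vertexMap c (x Fin.↑ˡ _)

  first : ∀ i → labelMap c i ≡ zero → labelMap c 0F ≡ zero
  first zero    eq = eq
  first (suc i) eq = contradiction (subst (labelMap c 0F Fin.<_) eq (labelMap-mono c {0F} {suc i} z<s)) λ ()

  ab-first : labelMap c 0F ≡ zero
  ab-first = first i eq

  old : ∀ i → ∃[ l ] labelMap c (suc i) ≡ suc l
  old i with labelMap c (suc i) | labelMap-mono c {0F} {suc i} z<s
  ... | suc l | _ = l , refl

  below : ∀ i j → suc i Fin.< suc j → proj₁ (old i) Fin.< proj₁ (old j)
  below i j i<j = s<s⁻¹ (subst₂ Fin._<_ (proj₂ (old i)) (proj₂ (old j)) (labelMap-mono c i<j))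

module _ (H : EdgeOrderedGraph n) (d : ℕ) where

  private
    es = edges H

    -- Vacuous unless `v` is a neighbour of `x`, so only neighbours constrain `x`.
    Fits : Fin n → Fin (suc d) → Fin n → Set
    Fits v i x = ∀ l → edgeAt H l Joins x and v → rank x es l ≡ toℕ i

    fits? : ∀ v i x → Dec (Fits v i x)
    fits? v i x = Fin.all? λ l → joins? (edgeAt H l) x v →-dec (rank x es l ℕ.≟ toℕ i)

    Adjacent : Fin n → Fin n → Set
    Adjacent x v = ∃[ l ] edgeAt H l Joins x and v

    adjacent? : ∀ x v → Dec (Adjacent x v)
    adjacent? x v = Fin.any? λ l → joins? (edgeAt H l) x v

    light? : ∀ x → Dec (deg x es ≤ d)
    light? x = deg x es ℕ.≤? d

    light : List (Fin n)
    light = filter light? (allFin n)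

    adjacent⇒fits : ∀ {x v} → deg x es ≤ d → Adjacent x v → ∃[ i ] Fits v i x
    adjacent⇒fits {x} x-light (l , j) = fromℕ< rank≤d , λ l′ j′ →
      trans (cong (rank x es) (lookup-injective (unique H) (joins-unique j′ j))) (sym (Fin.toℕ-fromℕ< rank≤d))
      where
      rank≤d : rank x es l < suc d
      rank≤d = ℕ.<-≤-trans (rank<deg es (joins⇒incident (edgeAt H l) j)) (ℕ.m≤n⇒m≤1+n x-light)

    -- A light vertex has at most `d` neighbours, hence at most `d` constraining vertices.
    weight-light : ∀ {x} → x ∈ light →
                   suc d ^ length (allFin n) ≤ weight fits? (allFin n) x * suc d ^ d
    weight-light {x} x∈ = ℕ.≤-trans
      (weight-bound fits? (adjacent? x) (adjacent⇒fits x-light) (λ ¬adj i l j → contradiction (l , j) ¬adj) (allFin n))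
      (ℕ.*-monoʳ-≤ (weight fits? (allFin n) x) (ℕ.^-monoʳ-≤ (suc d) (ℕ.≤-trans few x-light)))
      where
      x-light = proj₂ (∈-filter⁻ light? {xs = allFin n} x∈)
      few : length (filter (adjacent? x) (allFin n)) ≤ deg x es
      few = neighbours≤deg es (Unique.filter⁺ (adjacent? x) (Unique.allFin⁺ n)) λ z∈ →
        let l , j = proj₂ (∈-filter⁻ (adjacent? x) {xs = allFin n} z∈) in edgeAt H l , ∈-lookup l , j

    -- Common ranks of v and w put their edges in the same order at a and at b.
    common-fits⇒¬separated : ∀ {a b} → (∀ v → ∃[ i ] Fits v i a × Fits v i b) → ¬ Separated H a b
    common-fits⇒¬separated fit sep with fit (Separated.v sep) | fit (Separated.w sep)
    ... | _ , fit-av , fit-bv | _ , fit-aw , fit-bw = ℕ.<-asym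
      (subst₂ _<_ (fit-av av joins-av) (fit-aw aw joins-aw) (rank-mono-< es (joins⇒incident (edgeAt H av) joins-av) av<aw))
      (subst₂ _<_ (fit-bw bw joins-bw) (fit-bv bv joins-bv) (rank-mono-< es (joins⇒incident (edgeAt H bw) joins-bw) bw<bv))
      where open Separated sep

  -- The weights of the light vertices bound their number from above by the number of survivors
  -- times `suc d ^ d`, and the survivors form a clique of at most `suc d` vertices.
  light≤ : ∀ {G : EdgeOrderedGraph k} → SemisaturatedMin (D₀ ⊕ G) H →
           length (filter (λ x → deg x es ℕ.≤? d) (allFin n)) ≤ suc d ^ suc d
  light≤ {G = G} semi with survivors fits? (allFin n) light
  ... | ys , many , ys⊆ , ys! , fit = ℕ.*-cancelʳ-≤ _ _ (suc d ^ N) {{ℕ.m^n≢0 (suc d) N}} (begin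
    length light * suc d ^ N
      ≤⟨ length*≤∑* weight-light ⟩
    ∑ light (weight fits? (allFin n)) * suc d ^ d
      ≤⟨ ℕ.*-monoˡ-≤ (suc d ^ d) many ⟩
    length ys * suc d ^ N * suc d ^ d
      ≤⟨ ℕ.*-monoˡ-≤ (suc d ^ d) (ℕ.*-monoˡ-≤ (suc d ^ N)
           (clique≤ (ys! (Unique.filter⁺ light? (Unique.allFin⁺ n))) ys⊆
             λ a∈ b∈ v → let i , f = fit (∈-allFin v) in i , f a∈ , f b∈)) ⟩
    suc d * suc d ^ N * suc d ^ d
      ≡⟨ rearrange (suc d) (suc d ^ N) (suc d ^ d) ⟩
    suc d * suc d ^ d * suc d ^ N ∎)
    where
    open ℕ.≤-Reasoning
    N = length (allFin n)
    rearrange : ∀ a b c → a * b * c ≡ a * c * b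
    rearrange = solve-∀

    joined : ∀ {a b} → a ≢ b → (∀ v → ∃[ i ] Fits v i a × Fits v i b) →
             ∃[ e ] e ∈ es × e Joins a and b
    joined {a} {b} a≢b fit with edgeBetween a≢b
    ... | e , j with member? _≟ᵉ_ e es
    ...   | yes e∈ = e , e∈ , j
    ...   | no  e∉ with newCopy⇒separated {G = G} e∉ (semi e e∉)
    ...     | a′ , b′ , j′ , sep = contradiction sep (common-fits⇒¬separated λ v →
      -- The copy may name the two ends of `e` in the other order, so the common value is carried
      -- along the edge.
      let i , fa , fb = fit v
          fa′ , fb′   = joins-transport (Fits v i) e j j′ fa fb
      in i , fa′ , fb′)

    clique≤ : ∀ {ys} → Unique ys → ys ⊆ light →
              (∀ {a b} → a ∈ ys → b ∈ ys → ∀ v → ∃[ i ] Fits v i a × Fits v i b) →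
              length ys ≤ suc d
    clique≤ []        _   _   = z≤n
    -- The other members are neighbours of the first one, whose degree is at most `d`.
    clique≤ (y∉ ∷ zs!) ⊆light fit = s≤s (ℕ.≤-trans
      (neighbours≤deg es zs! λ z∈ → joined (All.lookup y∉ z∈) (fit (here refl) (there z∈)))
      (proj₂ (∈-filter⁻ light? {xs = allFin n} (⊆light (here refl)))))

  -- The average degree is less than half of `suc d`, so by `markov` more than half of the vertices
  -- are light.
  vertices< : ∀ {G : EdgeOrderedGraph k} → SemisaturatedMin (D₀ ⊕ G) H →
              4 * size H < suc d * n → n < 2 * suc d ^ suc d
  vertices< {G = G} semi few = ℕ.<-≤-trans
    (ℕ.*-cancelʳ-< (suc d) n (2 * length light) (ℕ.+-cancelˡ-< (suc d * n) _ _ (begin-strict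
      suc d * n + n * suc d
        ≡⟨ double (suc d) n ⟩
      2 * (n * suc d)
        ≡⟨ cong (λ l → 2 * (l * suc d)) (length-tabulate {n = n} id) ⟨
      2 * (length (allFin n) * suc d)
        ≤⟨ ℕ.*-monoʳ-≤ 2 (markov light? (λ x → deg x es) d ℕ.≰⇒> (allFin n)) ⟩
      2 * (∑ (allFin n) (λ x → deg x es) + length light * suc d)
        ≤⟨ ℕ.*-monoʳ-≤ 2 (ℕ.+-monoˡ-≤ _ (∑deg≤ es)) ⟩
      2 * (size H * 2 + length light * suc d)
        ≡⟨ regroup (size H) (length light) (suc d) ⟩
      4 * size H + 2 * length light * suc d
        <⟨ ℕ.+-monoˡ-< _ few ⟩
      suc d * n + 2 * length light * suc d ∎)))
    (ℕ.*-monoʳ-≤ 2 (light≤ {G = G} semi))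
    where
    open ℕ.≤-Reasoning
    double : ∀ a b → a * b + b * a ≡ 2 * (b * a)
    double = solve-∀
    regroup : ∀ a b c → 2 * (a * 2 + b * c) ≡ 4 * a + 2 * b * c
    regroup = solve-∀

-- Integer logarithms and the resulting lower bound.

log₂<-if-<2^ : ∀ m {n} .{{_ : NonZero n}} → n < 2 ^ m → ⌊log₂ n ⌋ < m
log₂<-if-<2^ zero    {suc _}       (s≤s ())
log₂<-if-<2^ (suc m) {suc zero}    _      = z<s
log₂<-if-<2^ (suc m) {suc (suc n)} n<2^1+m = half _ refl
  (log₂<-if-<2^ m {suc ⌊ n /2⌋} (ℕ.*-cancelˡ-< 2 _ _ (ℕ.≤-<-trans 2*half≤ n<2^1+m)))
  where
  2*half≤ : 2 * suc ⌊ n /2⌋ ≤ suc (suc n)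
  2*half≤ = begin
    2 * suc ⌊ n /2⌋                     ≡⟨ ℕ.*-distribˡ-+ 2 1 ⌊ n /2⌋ ⟩
    2 + (⌊ n /2⌋ + (⌊ n /2⌋ + 0))       ≡⟨ cong (λ h → 2 + (⌊ n /2⌋ + h)) (ℕ.+-identityʳ _) ⟩
    2 + (⌊ n /2⌋ + ⌊ n /2⌋)             ≤⟨ ℕ.+-monoʳ-≤ (2 + ⌊ n /2⌋) (ℕ.⌊n/2⌋≤⌈n/2⌉ n) ⟩
    2 + (⌊ n /2⌋ + _)                   ≡⟨ cong (2 +_) (ℕ.⌊n/2⌋+⌈n/2⌉≡n n) ⟩
    2 + n                               ∎
    where open ℕ.≤-Reasoning

  -- Splitting on the logarithm itself makes the truncated `∸ 1` exact in the successor case.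
  half : ∀ L → L ≡ ⌊log₂ suc (suc n) ⌋ → ⌊log₂ suc ⌊ n /2⌋ ⌋ < m → L < suc m
  half zero    _  _  = z<s
  half (suc L) eq lt = s<s (subst (_< m) (trans (⌊log₂⌊n/2⌋⌋≡⌊log₂n⌋∸1 (suc (suc n))) (cong (_∸ 1) (sym eq))) lt)

2^log₂≤ : ∀ n .{{_ : NonZero n}} → 2 ^ ⌊log₂ n ⌋ ≤ n
2^log₂≤ n = ℕ.≮⇒≥ λ n< → ℕ.n≮n _ (log₂<-if-<2^ ⌊log₂ n ⌋ n<)

<2^1+log₂ : ∀ n → n < 2 ^ suc ⌊log₂ n ⌋
<2^1+log₂ n = ℕ.≰⇒> λ 2^≤n → ℕ.1+n≰n
  (ℕ.≤-trans (ℕ.≤-reflexive (sym (⌊log₂[2^n]⌋≡n (suc ⌊log₂ n ⌋)))) (⌊log₂⌋-mono-≤ 2^≤n))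

1+n≤2^n : ∀ n → suc n ≤ 2 ^ n
1+n≤2^n zero    = ℕ.≤-refl
1+n≤2^n (suc n) = ℕ.+-mono-≤ (ℕ.m^n>0 2 n) (ℕ.≤-trans (1+n≤2^n n) (ℕ.m≤m+n _ 0))

-- By `suc d ≤ 2 ^ d` the hypothesis gives `n < 2 ^ suc (d * suc d)`, so the logarithm is at most
-- `d * suc d`.
log₂-bound : ∀ {n d} .{{_ : NonZero n}} → n < 2 * suc d ^ suc d → ⌊log₂ n ⌋ ≤ 2 * (d * d)
log₂-bound {n} {d} n< = ℕ.≤-trans (ℕ.≤-pred (log₂<-if-<2^ (suc (d * suc d)) (ℕ.<-≤-trans n< (begin
    2 * suc d ^ suc d    ≤⟨ ℕ.*-monoʳ-≤ 2 (ℕ.^-monoˡ-≤ (suc d) (1+n≤2^n d)) ⟩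
    2 * (2 ^ d) ^ suc d  ≡⟨ cong (2 *_) (ℕ.^-*-assoc 2 d (suc d)) ⟩
    2 * 2 ^ (d * suc d)  ∎))))
  (d*1+d≤ d)
  where
  open ℕ.≤-Reasoning
  d*1+d≤ : ∀ d → d * suc d ≤ 2 * (d * d)
  d*1+d≤ zero    = z≤n
  d*1+d≤ (suc d) = begin
    suc d * suc (suc d)      ≡⟨ ℕ.*-suc (suc d) (suc d) ⟩
    suc d + suc d * suc d    ≤⟨ ℕ.+-monoˡ-≤ (suc d * suc d) (ℕ.m≤m*n (suc d) (suc d)) ⟩
    suc d * suc d + suc d * suc d       ≡⟨ cong (suc d * suc d +_) (ℕ.+-identityʳ _) ⟨
    2 * (suc d * suc d)      ∎

semisaturated-size≥ : ∀ {G : EdgeOrderedGraph k} (H : EdgeOrderedGraph n) .{{_ : NonZero n}} →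
                      SemisaturatedMin (D₀ ⊕ G) H → n ^ 2 * ⌊log₂ n ⌋ ≤ (6 * size H) ^ 2
semisaturated-size≥ {n = n} {G} H semi = begin
  n ^ 2 * ⌊log₂ n ⌋
    ≤⟨ ℕ.*-monoʳ-≤ (n ^ 2) (log₂-bound {n} {d} (vertices< H d {G = G} semi 4E<)) ⟩
  n ^ 2 * (2 * (d * d))
    ≡⟨ regroup n d ⟩
  2 * ((d * n) * (d * n))
    ≤⟨ ℕ.*-monoʳ-≤ 2 (ℕ.*-mono-≤ dn≤ dn≤) ⟩
  2 * (4 * E * (4 * E))
    -- The factor 32 is raised to 36, the square of 6.
    ≤⟨ ℕ.m≤m+n _ (4 * (E * E)) ⟩
  2 * (4 * E * (4 * E)) + 4 * (E * E)
    ≡⟨ square E ⟩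
  (6 * E) ^ 2 ∎
  where
  open ℕ.≤-Reasoning
  E = size H
  -- The least `d` with `4 * E < suc d * n`; conversely `d * n ≤ 4 * E` turns the bound in `d` into
  -- one in `E`.
  d = 4 * E / n
  dn≤ : d * n ≤ 4 * E
  dn≤ = m/n*n≤m (4 * E) n
  4E< : 4 * E < suc d * n
  4E< = begin-strict
    4 * E                        ≡⟨ m≡m%n+[m/n]*n (4 * E) n ⟩
    _ + d * n                    <⟨ ℕ.+-monoˡ-< (d * n) (m%n<n (4 * E) n) ⟩
    n + d * n                    ∎
  regroup : ∀ n d → n * (n * 1) * (2 * (d * d)) ≡ 2 * ((d * n) * (d * n))
  regroup = solve-∀
  square : ∀ e → 2 * (4 * e * (4 * e)) + 4 * (e * e) ≡ 6 * e * (6 * e * 1)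
  square = solve-∀

-- The upper bound

allPairs-lookup : ∀ {R : A → A → Set} {xs} → AllPairs R xs → ∀ {i j} → i Fin.< j →
                  R (lookup xs i) (lookup xs j)
allPairs-lookup {xs = _ ∷ xs} (Rx ∷ _) {zero}  {suc j} _         = All.lookup Rx (∈-lookup {xs = xs} j)
allPairs-lookup {xs = _ ∷ xs} (_ ∷ Rxs) {suc i} {suc j} (s<s i<j) = allPairs-lookup Rxs i<j

-- Of two elements at different places the earlier is related to the later, so refuting `R y x` puts
-- `x` first; `x ≢ y` excludes a common place.
index-< : ∀ {R : A → A → Set} {xs x y} → AllPairs R xs → x ≢ y → ¬ R y x →
          (x∈ : x ∈ xs) (y∈ : y ∈ xs) → index x∈ Fin.< index y∈
index-< _         x≢y _   (here refl) (here refl) = contradiction refl x≢y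
index-< _         _   _   (here refl) (there _)   = z<s
index-< (Rx ∷ _)  _   ¬R  (there x∈)  (here refl) = contradiction (All.lookup Rx x∈) ¬R
index-< (_ ∷ Rxs) x≢y ¬R  (there x∈)  (there y∈)  = s<s (index-< Rxs x≢y ¬R x∈ y∈)

-- Positions are compared through `toℕ`, since they index different lists.
lookup-++ˡ : ∀ (xs : List A) {ys i i′} → toℕ i ≡ toℕ i′ → lookup (xs ++ ys) i ≡ lookup xs i′
lookup-++ˡ (x ∷ xs) {i = zero}  {zero}  _  = refl
lookup-++ˡ (x ∷ xs) {i = suc i} {suc j} eq = lookup-++ˡ xs (ℕ.suc-injective eq)

lookup-++ʳ : ∀ (xs : List A) {ys i j} → toℕ i ≡ length xs + toℕ j → lookup (xs ++ ys) i ≡ lookup ys j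
lookup-++ʳ []       {ys} eq = cong (lookup ys) (Fin.toℕ-injective eq)
lookup-++ʳ (x ∷ xs) {i = suc i} eq = lookup-++ʳ xs (ℕ.suc-injective eq)

lookup-map : ∀ (f : A → B) xs {i i′} → toℕ i ≡ toℕ i′ → lookup (map f xs) i ≡ f (lookup xs i′)
lookup-map f (x ∷ xs) {zero}  {zero}  _  = refl
lookup-map f (x ∷ xs) {suc i} {suc j} eq = lookup-map f xs (ℕ.suc-injective eq)

joins⇒≢ : ∀ {e : Edge n} {u v} → e Joins u and v → u ≢ v
joins⇒≢ {e = edge _ _ p} (inj₁ (refl , refl)) refl = ⊥-elim-irr (ℕ.<-irrefl refl p)
joins⇒≢ {e = edge _ _ p} (inj₂ (refl , refl)) refl = ⊥-elim-irr (ℕ.<-irrefl refl p)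

joins-resp-≡ : ∀ {e e′ : Edge n} {u u′ v v′} → e ≡ e′ → u ≡ u′ → v ≡ v′ →
               e′ Joins u′ and v′ → e Joins u and v
joins-resp-≡ refl refl refl j = j

joins-injectˡ : ∀ (e : Edge n) {u v} → e Joins u and v → injectˡ {n = k} e Joins (u ↑ˡ k) and (v ↑ˡ k)
joins-injectˡ {k = k} _ = Sum.map (Prod.map (cong (_↑ˡ k)) (cong (_↑ˡ k))) (Prod.map (cong (_↑ˡ k)) (cong (_↑ˡ k)))

-- The added edge plays `ab`. Joined vertices are distinct, and `v` differs from `w` because `av`
-- and `aw` are two different edges at `a`.
separated⇒newCopy : ∀ {H : EdgeOrderedGraph n} {e a b} e∉H → e Joins a and b → Separated H a b →
                    NewCopy D₀ H e e∉H
separated⇒newCopy {H = H} {e} {a} {b} e∉H joins-ab sep = record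
    { vertexMap           = lookup vertices
    ; vertexMap-injective = lookup-injective distinct
    ; labelMap            = lookup labels
    ; labelMap-mono       = allPairs-lookup (Linked⇒AllPairs Fin.<-trans increasing)
    ; incident            = λ where
        0F → joins-ab
        1F → joins-av
        2F → joins-aw
        3F → joins-bw
        4F → joins-bv
    } , 0F , refl
  where
  open Separated sep

  v≢w : v ≢ w
  v≢w v≡w = Fin.<-irrefl (lookup-injective (unique H)
    (joins-unique {e = edgeAt H av} (subst (edgeAt H av Joins a and_) v≡w joins-av) joins-aw)) av<aw

  vertices : List (Fin _)
  vertices = a ∷ b ∷ v ∷ w ∷ []

  distinct : Unique vertices
  distinct = (joins⇒≢ {e = e} joins-ab ∷ joins⇒≢ {e = edgeAt H av} joins-av ∷ joins⇒≢ {e = edgeAt H aw} joins-aw ∷ [])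
           ∷ (joins⇒≢ {e = edgeAt H bv} joins-bv ∷ joins⇒≢ {e = edgeAt H bw} joins-bw ∷ [])
           ∷ (v≢w ∷ [])
           ∷ []
           ∷ []

  labels : List (Label (insertMin H e e∉H))
  labels = zero ∷ suc av ∷ suc aw ∷ suc bw ∷ suc bv ∷ []

  increasing : Linked Fin._<_ labels
  increasing = z<s ∷ s<s av<aw ∷ s<s aw<bw ∷ s<s bw<bv ∷ [-]

-- Labels and copies in disjoint unions.

module _ (F : EdgeOrderedGraph m) (G : EdgeOrderedGraph n) where

  size-⊕ : size (F ⊕ G) ≡ size F + size G
  size-⊕ = trans (length-++ (map injectˡ (edges F)))
                 (cong₂ _+_ (length-map injectˡ (edges F)) (length-map injectʳ (edges G)))

  labelˡ : Label F → Label (F ⊕ G)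
  labelˡ i = cast (sym size-⊕) (i ↑ˡ size G)

  labelʳ : Label G → Label (F ⊕ G)
  labelʳ j = cast (sym size-⊕) (size F ↑ʳ j)

  splitLabel : Label (F ⊕ G) → Label F ⊎ Label G
  splitLabel = splitAt (size F) ∘ cast size-⊕

  splitLabel-labelˡ : ∀ i → splitLabel (labelˡ i) ≡ inj₁ i
  splitLabel-labelˡ i = trans (cong (splitAt (size F)) (Fin.cast-involutive size-⊕ (sym size-⊕) _))
                              (Fin.splitAt-↑ˡ (size F) i (size G))

  toℕ-labelˡ : ∀ i → toℕ (labelˡ i) ≡ toℕ i
  toℕ-labelˡ i = trans (Fin.toℕ-cast (sym size-⊕) _) (Fin.toℕ-↑ˡ i (size G))

  toℕ-labelʳ : ∀ j → toℕ (labelʳ j) ≡ size F + toℕ j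
  toℕ-labelʳ j = trans (Fin.toℕ-cast (sym size-⊕) _) (Fin.toℕ-↑ʳ (size F) j)

  data LabelView : Label (F ⊕ G) → Set where
    left  : ∀ i → LabelView (labelˡ i)
    right : ∀ j → LabelView (labelʳ j)

  labelView : ∀ l → LabelView l
  labelView l with splitLabel l in eq
  ... | inj₁ i = subst LabelView (trans (cong (cast (sym size-⊕)) (Fin.splitAt⁻¹-↑ˡ eq))
                                        (Fin.cast-involutive (sym size-⊕) size-⊕ l)) (left i)
  ... | inj₂ j = subst LabelView (trans (cong (cast (sym size-⊕)) (Fin.splitAt⁻¹-↑ʳ eq))
                                        (Fin.cast-involutive (sym size-⊕) size-⊕ l)) (right j)

  splitLabel-labelʳ : ∀ j → splitLabel (labelʳ j) ≡ inj₂ j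
  splitLabel-labelʳ j = trans (cong (splitAt (size F)) (Fin.cast-involutive size-⊕ (sym size-⊕) _))
                              (Fin.splitAt-↑ʳ (size F) (size G) j)

  edgeAt-labelˡ : ∀ i → edgeAt (F ⊕ G) (labelˡ i) ≡ injectˡ (edgeAt F i)
  edgeAt-labelˡ i = trans
    (lookup-++ˡ (map injectˡ (edges F)) (trans (toℕ-labelˡ i) (sym (Fin.toℕ-cast (sym (length-map injectˡ (edges F))) i))))
    (lookup-map injectˡ (edges F) (Fin.toℕ-cast (sym (length-map injectˡ (edges F))) i))

  edgeAt-labelʳ : ∀ j → edgeAt (F ⊕ G) (labelʳ j) ≡ injectʳ (edgeAt G j)
  edgeAt-labelʳ j = trans
    (lookup-++ʳ (map injectˡ (edges F)) (trans (toℕ-labelʳ j)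
      (cong₂ _+_ (sym (length-map injectˡ (edges F))) (sym (Fin.toℕ-cast (sym (length-map injectʳ (edges G))) j)))))
    (lookup-map injectʳ (edges G) (Fin.toℕ-cast (sym (length-map injectʳ (edges G))) j))

  labelˡ<labelʳ : ∀ i j → labelˡ i Fin.< labelʳ j
  labelˡ<labelʳ i j = subst₂ _<_ (sym (toℕ-labelˡ i)) (sym (toℕ-labelʳ j))
    (ℕ.<-≤-trans (Fin.toℕ<n i) (ℕ.m≤m+n (size F) (toℕ j)))

  labelˡ-mono-< : ∀ {i i′} → i Fin.< i′ → labelˡ i Fin.< labelˡ i′
  labelˡ-mono-< = subst₂ _<_ (sym (toℕ-labelˡ _)) (sym (toℕ-labelˡ _))

  labelˡ-cancel-< : ∀ {i i′} → labelˡ i Fin.< labelˡ i′ → i Fin.< i′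
  labelˡ-cancel-< = subst₂ _<_ (toℕ-labelˡ _) (toℕ-labelˡ _)

  labelʳ-mono-< : ∀ {j j′} → j Fin.< j′ → labelʳ j Fin.< labelʳ j′
  labelʳ-mono-< j< = subst₂ _<_ (sym (toℕ-labelʳ _)) (sym (toℕ-labelʳ _)) (ℕ.+-monoʳ-< (size F) j<)

  labelʳ-cancel-< : ∀ {j j′} → labelʳ j Fin.< labelʳ j′ → j Fin.< j′
  labelʳ-cancel-< j< = ℕ.+-cancelˡ-< (size F) _ _ (subst₂ _<_ (toℕ-labelʳ _) (toℕ-labelʳ _) j<)

-- The copy is extended by the identity on `G`; the order is respected since both unions put `G` on
-- top.
⊕-newCopy : ∀ {F : EdgeOrderedGraph m} {H : EdgeOrderedGraph n} (G : EdgeOrderedGraph k) {e} e∉H e∉H⊕G →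
            NewCopy F H e e∉H → NewCopy (F ⊕ G) (H ⊕ G) (injectˡ e) e∉H⊕G
⊕-newCopy {m = m} {n} {k} {F} {H} G {e} e∉H e∉H⊕G (c , i , eq) = record
    { vertexMap           = φ
    ; vertexMap-injective = φ-injective
    ; labelMap            = ℓ
    ; labelMap-mono       = ℓ-mono
    ; incident            = ℓ-incident
    } , labelˡ F G i , trans (ℓ-labelˡ i) (cong (labelˡ K G) eq)
  where
  -- `K ⊕ G` and `H ⊕ G` with `injectˡ e` inserted have the same list of edges, hence the same
  -- labels.
  K = insertMin H e e∉H

  μ : Fin m ⊎ Fin k → Fin n ⊎ Fin k
  μ = Sum.map₁ (vertexMap c)

  φ : Fin (m + k) → Fin (n + k)
  φ = Fin.join n k ∘ μ ∘ splitAt m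

  φ-↑ˡ : ∀ x → φ (x ↑ˡ k) ≡ vertexMap c x ↑ˡ k
  φ-↑ˡ x = cong (Fin.join n k ∘ μ) (Fin.splitAt-↑ˡ m x k)

  φ-↑ʳ : ∀ x → φ (m ↑ʳ x) ≡ n ↑ʳ x
  φ-↑ʳ x = cong (Fin.join n k ∘ μ) (Fin.splitAt-↑ʳ m k x)

  μ-injective : Injective _≡_ _≡_ μ
  μ-injective {inj₁ _} {inj₁ _} eq   = cong inj₁ (vertexMap-injective c (inj₁-injective eq))
  μ-injective {inj₂ _} {inj₂ _} refl = refl

  φ-injective : Injective _≡_ _≡_ φ
  φ-injective {x} {y} eq = trans (sym (Fin.join-splitAt m k x)) (trans
    (cong (Fin.join m k) (μ-injective {splitAt m x} {splitAt m y} (trans (sym (Fin.splitAt-join n k (μ (splitAt m x))))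
      (trans (cong (splitAt n) eq) (Fin.splitAt-join n k (μ (splitAt m y)))))))
    (Fin.join-splitAt m k y))

  ℓ : Label (F ⊕ G) → Label (K ⊕ G)
  ℓ = [ labelˡ K G ∘ labelMap c , labelʳ K G ]′ ∘ splitLabel F G

  ℓ-labelˡ : ∀ i → ℓ (labelˡ F G i) ≡ labelˡ K G (labelMap c i)
  ℓ-labelˡ i = cong [ labelˡ K G ∘ labelMap c , labelʳ K G ]′ (splitLabel-labelˡ F G i)

  ℓ-labelʳ : ∀ j → ℓ (labelʳ F G j) ≡ labelʳ K G j
  ℓ-labelʳ j = cong [ labelˡ K G ∘ labelMap c , labelʳ K G ]′ (splitLabel-labelʳ F G j)

  ℓ-mono : ℓ Preserves Fin._<_ ⟶ Fin._<_
  ℓ-mono {x} {y} x<y with labelView F G x | labelView F G y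
  ... | left i  | left i′  = subst₂ Fin._<_ (sym (ℓ-labelˡ i)) (sym (ℓ-labelˡ i′))
                               (labelˡ-mono-< K G (labelMap-mono c (labelˡ-cancel-< F G x<y)))
  ... | left i  | right j  = subst₂ Fin._<_ (sym (ℓ-labelˡ i)) (sym (ℓ-labelʳ j)) (labelˡ<labelʳ K G (labelMap c i) j)
  ... | right j | left i   = contradiction x<y (ℕ.<-asym (labelˡ<labelʳ F G i j))
  ... | right j | right j′ = subst₂ Fin._<_ (sym (ℓ-labelʳ j)) (sym (ℓ-labelʳ j′))
                               (labelʳ-mono-< K G (labelʳ-cancel-< F G x<y))

  ℓ-incident : ∀ l → edgeAt (K ⊕ G) (ℓ l) Joins φ (src (edgeAt (F ⊕ G) l)) and φ (tgt (edgeAt (F ⊕ G) l))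
  ℓ-incident l with labelView F G l
  ... | left i  = joins-resp-≡
    (trans (cong (edgeAt (K ⊕ G)) (ℓ-labelˡ i)) (edgeAt-labelˡ K G (labelMap c i)))
    (trans (cong (φ ∘ src) (edgeAt-labelˡ F G i)) (φ-↑ˡ _))
    (trans (cong (φ ∘ tgt) (edgeAt-labelˡ F G i)) (φ-↑ˡ _))
    (joins-injectˡ (edgeAt K (labelMap c i)) (incident c i))
  ... | right j = joins-resp-≡
    (trans (cong (edgeAt (K ⊕ G)) (ℓ-labelʳ j)) (edgeAt-labelʳ K G j))
    (trans (cong (φ ∘ src) (edgeAt-labelʳ F G j)) (φ-↑ʳ _))
    (trans (cong (φ ∘ tgt) (edgeAt-labelʳ F G j)) (φ-↑ʳ _))
    (inj₁ (refl , refl))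

-- The elements above `i` have distinct images above `f i`, so at least as many lie above `f i`.
-- Adding on both sides avoids subtraction.
mono⇒gap : ∀ {a b} (f : Fin a → Fin b) → f Preserves Fin._<_ ⟶ Fin._<_ →
           ∀ i → a + toℕ (f i) ≤ b + toℕ i
mono⇒gap {suc zero}    {b} f mono zero    = ℕ.≤-trans (Fin.toℕ<n (f zero)) (ℕ.≤-reflexive (sym (ℕ.+-identityʳ b)))
mono⇒gap {suc (suc a)} {b} f mono zero    = ℕ.≤-trans
  (ℕ.≤-trans (ℕ.≤-reflexive (sym (ℕ.+-suc (suc a) (toℕ (f zero))))) (ℕ.+-monoʳ-≤ (suc a) (mono {zero} {suc zero} z<s)))
  (mono⇒gap (f ∘ suc) (mono ∘ s<s) zero)
mono⇒gap {suc a}       {b} f mono (suc i) = ℕ.≤-trans (s≤s (mono⇒gap (f ∘ suc) (mono ∘ s<s) i))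
  (ℕ.≤-reflexive (sym (ℕ.+-suc b (toℕ i))))

Crosses : ℕ → Edge n → Set
Crosses s e = toℕ (src e) < s × s ≤ toℕ (tgt e)

crosses-ends : ∀ {s} (e : Edge n) {u v} → Crosses s e → e Joins u and v →
               (toℕ u < s × s ≤ toℕ v) ⊎ (toℕ v < s × s ≤ toℕ u)
crosses-ends _ cross (inj₁ (refl , refl)) = inj₁ cross
crosses-ends _ cross (inj₂ (refl , refl)) = inj₂ cross

-- Edges across a cut form a bipartite graph, which has no odd cycle.
crossing-no-triangle : ∀ {s} (e₁ e₂ e₃ : Edge n) {a b v} → Crosses s e₁ → Crosses s e₂ → Crosses s e₃ →
                       e₁ Joins a and b → e₂ Joins a and v → ¬ e₃ Joins b and v
crossing-no-triangle {s = s} e₁ e₂ e₃ c₁ c₂ c₃ j₁ j₂ j₃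
  with crosses-ends {s = s} e₁ c₁ j₁ | crosses-ends {s = s} e₂ c₂ j₂ | crosses-ends {s = s} e₃ c₃ j₃
... | inj₁ (_ , b≥) | _             | inj₁ (b< , _) = ℕ.<⇒≱ b< b≥
... | inj₁ (a< , _) | inj₂ (_ , a≥) | _             = ℕ.<⇒≱ a< a≥
... | inj₁ _        | inj₁ (_ , v≥) | inj₂ (v< , _) = ℕ.<⇒≱ v< v≥
... | inj₂ (b< , _) | _             | inj₂ (_ , b≥) = ℕ.<⇒≱ b< b≥
... | inj₂ (_ , a≥) | inj₁ (a< , _) | _             = ℕ.<⇒≱ a< a≥
... | inj₂ _        | inj₂ (v< , _) | inj₁ (_ , v≥) = ℕ.<⇒≱ v< v≥

-- The edges of D₀ have at least size G labels above them in D₀ ⊕ G, so a copy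
-- puts them among the labels of H.
crossing-free : ∀ s (H : EdgeOrderedGraph n) (G : EdgeOrderedGraph k) → All (Crosses s ∘ injectˡ {n = k}) (edges H) →
                (H ⊕ G) FreeOf (D₀ ⊕ G)
-- The edges 0, 1 and 4 of `D₀` are `ab`, `av` and `bv`, a triangle.
crossing-free {n} {k} s H G cross c = crossing-no-triangle {s = s} (edgeOf 0F) (edgeOf 1F) (edgeOf 4F)
    (crosses 0F z<s) (crosses 1F (s<s z<s)) (crosses 4F (s<s (s<s (s<s (s<s z<s)))))
    (incident c 0F) (incident c 1F) (incident c 4F)
  where
  edgeOf : ∀ i → Edge (n + k)
  edgeOf i = edgeAt (H ⊕ G) (labelMap c i)

  low : ∀ i → toℕ i < 5 → toℕ (labelMap c i) < size H
  low i i<5 = ℕ.+-cancelˡ-< (5 + size G) _ _ (begin-strict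
    5 + size G + toℕ (labelMap c i)
      ≡⟨ cong (_+ toℕ (labelMap c i)) (size-⊕ D₀ G) ⟨
    size (D₀ ⊕ G) + toℕ (labelMap c i)
      ≤⟨ mono⇒gap (labelMap c) (labelMap-mono c) i ⟩
    size (H ⊕ G) + toℕ i
      <⟨ ℕ.+-monoʳ-< (size (H ⊕ G)) i<5 ⟩
    size (H ⊕ G) + 5
      ≡⟨ cong (_+ 5) (size-⊕ H G) ⟩
    size H + size G + 5
      ≡⟨ rearrange (size H) (size G) ⟩
    5 + size G + size H ∎)
    where
    open ℕ.≤-Reasoning
    rearrange : ∀ h g → h + g + 5 ≡ 5 + g + h
    rearrange = solve-∀

  crosses : ∀ i → toℕ i < 5 → Crosses s (edgeOf i)
  crosses i i<5 with labelMap c i | low i i<5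
  ... | l | l<H with labelView H G l
  ...   | left  l′ = subst (Crosses s) (sym (edgeAt-labelˡ H G l′)) (All.lookup cross (∈-lookup l′))
  ...   | right l′ = contradiction (subst (_< size H) (toℕ-labelʳ H G l′) l<H) (ℕ.m+n≮m (size H) (toℕ l′))

-- The host graph.

funToFin-cong : ∀ {f g : Fin m → Fin n} → f ≗ g → funToFin f ≡ funToFin g
funToFin-cong {zero}  _   = refl
funToFin-cong {suc m} f≗g = cong₂ combine (f≗g zero) (funToFin-cong (f≗g ∘ suc))

finToFun-separates : ∀ {x y : Fin (n ^ m)} → x ≢ y → ∃[ i ] finToFun {n} {m} x i ≢ finToFun y i
finToFun-separates {n} {m} {x} {y} x≢y = Fin.¬∀⟶∃¬ m _ (λ i → finToFun {n} {m} x i Fin.≟ finToFun y i) λ eq →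
  x≢y (trans (sym (Fin.funToFin-finToFin {m} x)) (trans (funToFin-cong {m} eq) (Fin.funToFin-finToFin {m} y)))

-- The vertices are q thresholds and r digits, which form the hubs, and t codes.
-- Every code is joined to every hub; the edges at a smaller code come first, and
-- at a code digit i comes after the thresholds j < code i and before the others.
module Host (q r t : ℕ) (t≤q^r : t ≤ q ^ r) where

  hubs : ℕ
  hubs = q + r

  digit : Fin t → Fin r → Fin q
  digit a = finToFun {q} {r} (inject≤ a t≤q^r)

  -- Thresholds take odd values and digits even ones, so a threshold and a digit never tie.
  position : Fin t → Fin hubs → ℕ
  position a h = [ (λ j → suc (2 * toℕ j)) , (λ i → 2 * toℕ (digit a i)) ]′ (splitAt q h)

  position< : ∀ a h → position a h < 2 * q
  position< a h with splitAt q h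
  ... | inj₁ j = ℕ.≤-trans (ℕ.≤-reflexive (sym (ℕ.*-suc 2 (toℕ j)))) (ℕ.*-monoʳ-≤ 2 (Fin.toℕ<n j))
  ... | inj₂ i = ℕ.*-monoʳ-< 2 (Fin.toℕ<n (digit a i))

  -- Lexicographic order by code and then position: every code owns a block of `2 * q` values.
  key : Fin hubs × Fin t → ℕ
  key (h , a) = toℕ a * (2 * q) + position a h

  key-mono-code : ∀ {a b} h h′ → a Fin.< b → key (h , a) < key (h′ , b)
  key-mono-code {a} {b} h h′ a<b = begin-strict
    toℕ a * (2 * q) + position a h    <⟨ ℕ.+-monoʳ-< (toℕ a * (2 * q)) (position< a h) ⟩
    toℕ a * (2 * q) + 2 * q           ≡⟨ ℕ.+-comm (toℕ a * (2 * q)) (2 * q) ⟩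
    suc (toℕ a) * (2 * q)             ≤⟨ ℕ.*-monoˡ-≤ (2 * q) a<b ⟩
    toℕ b * (2 * q)                   ≤⟨ ℕ.m≤m+n _ (position b h′) ⟩
    toℕ b * (2 * q) + position b h′   ∎
    where open ℕ.≤-Reasoning

  open Data.List.Sort (On.decTotalOrder ℕ.≤-decTotalOrder key) using (sort; sort-↭; sort-↗)

  allPairs : List (Fin hubs × Fin t)
  allPairs = cartesianProduct (allFin hubs) (allFin t)

  pairs : List (Fin hubs × Fin t)
  pairs = sort allPairs

  ∈-pairs : ∀ p → p ∈ pairs
  ∈-pairs (h , a) = ∈-resp-↭ (↭-sym (sort-↭ allPairs)) (∈-cartesianProduct⁺ (∈-allFin h) (∈-allFin a))

  pairs-sorted : AllPairs (λ p p′ → key p ≤ key p′) pairs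
  pairs-sorted = Linked⇒AllPairs ℕ.≤-trans (sort-↗ allPairs)

  pairs-unique : Unique pairs
  pairs-unique = ↭ₛ.Unique-resp-↭ (setoid _) (↭⇒↭ₛ (↭-sym (sort-↭ allPairs)))
    (Unique.cartesianProduct⁺ (Unique.allFin⁺ hubs) (Unique.allFin⁺ t))

  spoke : Fin hubs × Fin t → Edge (hubs + t)
  spoke (h , a) = edge (h ↑ˡ t) (hubs ↑ʳ a)
    (subst₂ _<_ (sym (Fin.toℕ-↑ˡ h t)) (sym (Fin.toℕ-↑ʳ hubs a)) (ℕ.<-≤-trans (Fin.toℕ<n h) (ℕ.m≤m+n hubs (toℕ a))))

  spoke-injective : Injective _≡_ _≡_ spoke
  spoke-injective eq = cong₂ _,_ (Fin.↑ˡ-injective t _ _ (cong src eq)) (Fin.↑ʳ-injective hubs _ _ (cong tgt eq))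

  host : EdgeOrderedGraph (hubs + t)
  host = graph (map spoke pairs) (Unique.map⁺ spoke-injective pairs-unique)

  label : Fin hubs → Fin t → Label host
  label h a = index (∈-map⁺ spoke (∈-pairs (h , a)))

  label-< : ∀ {h a h′ a′} → key (h , a) < key (h′ , a′) → label h a Fin.< label h′ a′
  label-< {h} {a} {h′} {a′} lt = index-< {R = R} (AllPairs.map⁺ (AllPairs.map on-spokes pairs-sorted))
      (λ eq → ℕ.<-irrefl (cong key (spoke-injective eq)) lt) (λ R-eq → ℕ.<⇒≱ lt (R-eq refl refl))
      (∈-map⁺ spoke (∈-pairs (h , a))) (∈-map⁺ spoke (∈-pairs (h′ , a′)))
    where
    R : Edge (hubs + t) → Edge (hubs + t) → Set
    -- The order by `key` carried over to edges, quantified over preimages under `spoke`; these are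
    -- unique by injectivity.
    R e e′ = ∀ {p p′} → e ≡ spoke p → e′ ≡ spoke p′ → key p ≤ key p′

    on-spokes : ∀ {p p′} → key p ≤ key p′ → R (spoke p) (spoke p′)
    on-spokes le eq eq′ = subst₂ _≤_ (cong key (spoke-injective eq)) (cong key (spoke-injective eq′)) le

  label-joins : ∀ h a → edgeAt host (label h a) Joins hubs ↑ʳ a and (h ↑ˡ t)
  label-joins h a = inj₂ (cong src (sym spoke≡) , cong tgt (sym spoke≡))
    where
    spoke≡ : spoke (h , a) ≡ edgeAt host (label h a)
    spoke≡ = lookup-index (∈-map⁺ spoke (∈-pairs (h , a)))

  -- All edges at the smaller code come first, which gives `aw<bw`; the other two comparisons each
  -- take place at a single code.
  separatedBy : ∀ {a b} v w → a Fin.< b → position a v < position a w → position b w < position b v →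
                Separated host (hubs ↑ʳ a) (hubs ↑ʳ b)
  separatedBy {a} {b} v w a<b v<w w<v = record
    { av<aw    = label-< (ℕ.+-monoʳ-< (toℕ a * (2 * q)) v<w)
    ; aw<bw    = label-< (key-mono-code w w a<b)
    ; bw<bv    = label-< (ℕ.+-monoʳ-< (toℕ b * (2 * q)) w<v)
    ; joins-av = label-joins v a
    ; joins-aw = label-joins w a
    ; joins-bw = label-joins w b
    ; joins-bv = label-joins v b
    }

  position-threshold : ∀ a j → position a (j ↑ˡ r) ≡ suc (2 * toℕ j)
  position-threshold a j = cong [ _ , _ ]′ (Fin.splitAt-↑ˡ q j r)

  position-digit : ∀ a i → position a (q ↑ʳ i) ≡ 2 * toℕ (digit a i)
  position-digit a i = cong [ _ , _ ]′ (Fin.splitAt-↑ʳ q r i)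

  -- The threshold at the smaller value of a digit tells two codes apart.
  digit<threshold : ∀ a i {j} → digit a i ≡ j → position a (q ↑ʳ i) < position a (j ↑ˡ r)
  digit<threshold a i {j} refl = subst₂ _<_ (sym (position-digit a i)) (sym (position-threshold a j)) ℕ.≤-refl

  threshold<digit : ∀ a i {j} → j Fin.< digit a i → position a (j ↑ˡ r) < position a (q ↑ʳ i)
  threshold<digit a i {j} j< = subst₂ _<_ (sym (position-threshold a j)) (sym (position-digit a i))
    (ℕ.≤-trans (ℕ.≤-reflexive (sym (ℕ.*-suc 2 (toℕ j)))) (ℕ.*-monoʳ-≤ 2 j<))

  separated : ∀ {a b} → a Fin.< b → Separated host (hubs ↑ʳ a) (hubs ↑ʳ b)
  separated {a} {b} a<b
    with finToFun-separates {q} {r} (Fin.<⇒≢ a<b ∘ Fin.inject≤-injective t≤q^r t≤q^r a b)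
  ... | i , aᵢ≢bᵢ with Fin.<-cmp (digit a i) (digit b i)
  -- The hub that comes first at `a` plays `v`: the digit if its value is smaller at `a`, the
  -- threshold if it is larger.
  ...   | tri< aᵢ<bᵢ _ _ = separatedBy (q ↑ʳ i) (digit a i ↑ˡ r) a<b
                             (digit<threshold a i refl) (threshold<digit b i aᵢ<bᵢ)
  ...   | tri≈ _ aᵢ≡bᵢ _ = contradiction aᵢ≡bᵢ aᵢ≢bᵢ
  ...   | tri> _ _ bᵢ<aᵢ = separatedBy (digit b i ↑ˡ r) (q ↑ʳ i) a<b
                             (threshold<digit a i bᵢ<aᵢ) (digit<threshold b i refl)

  host-newCopy : ∀ {a b e} → e Joins (hubs ↑ʳ a) and (hubs ↑ʳ b) → ∀ e∉ → NewCopy D₀ host e e∉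
  host-newCopy {a} {b} {e} j e∉ with Fin.<-cmp a b
  ... | tri< a<b _ _ = separated⇒newCopy e∉ j (separated a<b)
  ... | tri≈ _ a≡b _ = contradiction (cong (hubs ↑ʳ_) a≡b) (joins⇒≢ {e = e} j)
  ... | tri> _ _ b<a = separated⇒newCopy e∉ (Sum.swap j) (separated b<a)

  module _ (k : ℕ) where

    -- Codes go to the left, hubs and vertices of `G` to the right, where `size≤` counts the edges.
    classify : Fin (hubs + t + k) → Fin t ⊎ Fin (hubs + k)
    classify x = [ [ inj₂ ∘ (_↑ˡ k) , inj₁ ]′ ∘ splitAt hubs , inj₂ ∘ (hubs ↑ʳ_) ]′ (splitAt (hubs + t) x)

    declassify : Fin t ⊎ Fin (hubs + k) → Fin (hubs + t + k)
    declassify = [ (λ a → (hubs ↑ʳ a) ↑ˡ k) , (λ z → [ (λ h → (h ↑ˡ t) ↑ˡ k) , (hubs + t ↑ʳ_) ]′ (splitAt hubs z)) ]′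

    declassify-classify : ∀ x → declassify (classify x) ≡ x
    declassify-classify x with splitAt (hubs + t) x in eq
    ... | inj₂ g rewrite Fin.splitAt-↑ʳ hubs k g = Fin.splitAt⁻¹-↑ʳ eq
    ... | inj₁ y with splitAt hubs y in eq′
    ...   | inj₁ h rewrite Fin.splitAt-↑ˡ hubs h k = trans (cong (_↑ˡ k) (Fin.splitAt⁻¹-↑ˡ eq′)) (Fin.splitAt⁻¹-↑ˡ eq)
    ...   | inj₂ a = trans (cong (_↑ˡ k) (Fin.splitAt⁻¹-↑ʳ eq′)) (Fin.splitAt⁻¹-↑ˡ eq)

    classify-injective : Injective _≡_ _≡_ classify
    classify-injective {x} {y} eq =
      trans (sym (declassify-classify x)) (trans (cong declassify eq) (declassify-classify y))

    classify-hub : ∀ h → classify ((h ↑ˡ t) ↑ˡ k) ≡ inj₂ (h ↑ˡ k)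
    classify-hub h rewrite Fin.splitAt-↑ˡ (hubs + t) (h ↑ˡ t) k | Fin.splitAt-↑ˡ hubs h t = refl

    classify-extra : ∀ g → classify (hubs + t ↑ʳ g) ≡ inj₂ (hubs ↑ʳ g)
    classify-extra g rewrite Fin.splitAt-↑ʳ (hubs + t) k g = refl

    classify-code : ∀ {x a} → classify x ≡ inj₁ a → (hubs ↑ʳ a) ↑ˡ k ≡ x
    classify-code {x} eq = trans (cong declassify (sym eq)) (declassify-classify x)

  -- A missing edge between two codes creates a new copy at once and every other edge is coded, so
  -- `saturate` keeps all edges coded.
  saturated-host : ∀ (G : EdgeOrderedGraph k) →
                   ∃[ K ] SaturatedMin (D₀ ⊕ G) K × size K ≤ (hubs + k) * (hubs + t + k)
  saturated-host {k} G = bounded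
      (saturate {F = D₀ ⊕ G} (host ⊕ G) (crossing-free hubs host G host-crosses) host-coded uncoded-new)
    where
    bounded : ∃[ K ] SaturatedMin (D₀ ⊕ G) K × All (∃ ∘ Coded (classify k)) (edges K) →
              ∃[ K ] SaturatedMin (D₀ ⊕ G) K × size K ≤ (hubs + k) * (hubs + t + k)
    bounded (K , sat , coded-all) = K , sat , size≤ (classify k) (classify-injective k) K coded-all

    spoke-crosses : ∀ p → Crosses hubs (injectˡ {n = k} (spoke p))
    spoke-crosses (h , a) =
        subst (_< hubs) (sym (trans (Fin.toℕ-↑ˡ (h ↑ˡ t) k) (Fin.toℕ-↑ˡ h t))) (Fin.toℕ<n h)
      , subst (hubs ≤_) (sym (trans (Fin.toℕ-↑ˡ (hubs ↑ʳ a) k) (Fin.toℕ-↑ʳ hubs a))) (ℕ.m≤m+n hubs (toℕ a))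

    host-crosses : All (Crosses hubs ∘ injectˡ {n = k}) (edges host)
    host-crosses = All.map⁺ (All.tabulate λ {p} _ → spoke-crosses p)

    host-coded : All (∃ ∘ Coded (classify k)) (edges (host ⊕ G))
    host-coded = All.++⁺ {xs = map injectˡ (edges host)} {ys = map injectʳ (edges G)}
      (All.map⁺ {xs = edges host} {f = injectˡ} (All.map⁺ {xs = pairs} {f = spoke} (All.tabulate λ {p} _ →
        coded (classify k) {e = injectˡ (spoke p)} (inj₁ (refl , refl)) (classify-hub k (proj₁ p)))))
      (All.map⁺ {xs = edges G} {f = injectʳ} (All.tabulate λ {e} _ →
        coded (classify k) {e = injectʳ e} (inj₁ (refl , refl)) (classify-extra k (src e))))

    code-edge-new : ∀ {e a b} → e Joins ((hubs ↑ʳ a) ↑ˡ k) and ((hubs ↑ʳ b) ↑ˡ k) →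
                    ∀ e∉ → NewCopy (D₀ ⊕ G) (host ⊕ G) e e∉
    code-edge-new {e} {a} {b} j e∉ with edgeBetween {u = hubs ↑ʳ a} {hubs ↑ʳ b} (λ eq → joins⇒≢ {e = e} j (cong (_↑ˡ k) eq))
    -- The ends determine an edge, so `e` is the image of `e₀`, and the new copy in `host` extends
    -- over `G`.
    ... | e₀ , j₀ with refl ← joins-unique {e = e} {injectˡ {n = k} e₀} j
                        (joins-injectˡ e₀ j₀) =
      ⊕-newCopy {F = D₀} {host} G e₀∉ e∉ (host-newCopy {a} {b} j₀ e₀∉)
      where
      e₀∉ : e₀ ∉ edges host
      e₀∉ e₀∈ = e∉ (∈-++⁺ˡ (∈-map⁺ injectˡ e₀∈))

    uncoded-new : ∀ e → ∃ (Coded (classify k) e) ⊎ (∀ e∉ → NewCopy (D₀ ⊕ G) (host ⊕ G) e e∉)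
    uncoded-new e with classify k (src e) in eq | classify k (tgt e) in eq′
    ... | inj₂ x | _      = inj₁ (coded (classify k) {e = e} (inj₁ (refl , refl)) eq)
    ... | inj₁ _ | inj₂ x = inj₁ (coded (classify k) {e = e} (inj₂ (refl , refl)) eq′)
    ... | inj₁ a | inj₁ b = inj₂ (code-edge-new (inj₁ (sym (classify-code k eq) , sym (classify-code k eq′))))

-- Choice of the parameters.

sat≤ : ∀ {G : EdgeOrderedGraph k} {n s} q r → n ≤ q ^ r → Is-satₘ n (D₀ ⊕ G) s → s ≤ (q + r + k) * n
-- With too few vertices for the hubs and `G` the trivial bound `n * n` is enough; otherwise all
-- remaining vertices become codes.
sat≤ {k} {G} {n} {s} q r n≤q^r least = [ crowded , roomy ]′ (ℕ.≤-total n (q + r + k))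
  where
  crowded : n ≤ q + r + k → s ≤ (q + r + k) * n
  crowded n≤ = let H , _ , size≡ = IsMinimumSize.attained least in
    ℕ.≤-trans (ℕ.≤-reflexive (sym size≡)) (ℕ.≤-trans (size≤n*n H) (ℕ.*-monoˡ-≤ n n≤))

  go : ∀ {n} t → t ≤ q ^ r → n ≡ q + r + t + k → Is-satₘ n (D₀ ⊕ G) s → s ≤ (q + r + k) * n
  go t t≤ refl least = let K , sat , small = Host.saturated-host q r t t≤ G in
    ℕ.≤-trans (IsMinimumSize.minimal least K sat) small

  roomy : q + r + k ≤ n → s ≤ (q + r + k) * n
  roomy ≤n = go (n ∸ (q + r + k)) (ℕ.≤-trans (ℕ.m∸n≤m n (q + r + k)) n≤q^r)
                (trans (sym (ℕ.m+[n∸m]≡n ≤n)) (rearrange (q + r) k _)) least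
    where
    rearrange : ∀ a b c → a + b + c ≡ a + c + b
    rearrange = solve-∀

-- With L = ⌊log₂ n⌋ and p half of log₂ L, q = 2 ^ p is about √L and r about L / p.
hub-count : ∀ k n → 16 ≤ n → ∃[ q ] ∃[ r ] n ≤ q ^ r ×
            (q + r + k) * ⌊log₂ ⌊log₂ n ⌋ ⌋ ≤ (11 + k) * ⌊log₂ n ⌋
hub-count k n 16≤n = 2 ^ p , r , n≤q^r , bound
  where
  open ℕ.≤-Reasoning
  L LL p r : ℕ
  L  = ⌊log₂ n ⌋
  LL = ⌊log₂ L ⌋

  -- The assumption `16 ≤ n` makes `p`, the divisor in `r`, positive.
  4≤L : 4 ≤ L
  4≤L = ℕ.≤-trans (ℕ.≤-reflexive (sym (⌊log₂[2^n]⌋≡n 4))) (⌊log₂⌋-mono-≤ 16≤n)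

  2≤LL : 2 ≤ LL
  2≤LL = ℕ.≤-trans (ℕ.≤-reflexive (sym (⌊log₂[2^n]⌋≡n 2))) (⌊log₂⌋-mono-≤ 4≤L)

  instance
    L≢0 : NonZero L
    L≢0 = >-nonZero (ℕ.≤-trans (s≤s z≤n) 4≤L)

  2^LL≤L : 2 ^ LL ≤ L
  2^LL≤L = 2^log₂≤ L

  p = ⌊ LL /2⌋

  1≤p : 1 ≤ p
  1≤p = ℕ.⌊n/2⌋-mono 2≤LL

  instance
    p≢0 : NonZero p
    p≢0 = >-nonZero 1≤p

  -- The inner successor is due to `n < 2 ^ suc L`; the outer one rounds up, so that
  -- `suc L ≤ r * p`.
  r = suc (suc L / p)

  p+p≤LL : p + p ≤ LL
  p+p≤LL = ℕ.≤-trans (ℕ.+-monoʳ-≤ p (ℕ.⌊n/2⌋≤⌈n/2⌉ LL)) (ℕ.≤-reflexive (ℕ.⌊n/2⌋+⌈n/2⌉≡n LL))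

  ⌈/2⌉≤1+⌊/2⌋ : ∀ n → ⌈ n /2⌉ ≤ suc ⌊ n /2⌋
  ⌈/2⌉≤1+⌊/2⌋ zero          = z≤n
  ⌈/2⌉≤1+⌊/2⌋ (suc zero)    = ℕ.≤-refl
  ⌈/2⌉≤1+⌊/2⌋ (suc (suc n)) = s≤s (⌈/2⌉≤1+⌊/2⌋ n)

  LL≤ : LL ≤ p + suc p
  LL≤ = ℕ.≤-trans (ℕ.≤-reflexive (sym (ℕ.⌊n/2⌋+⌈n/2⌉≡n LL))) (ℕ.+-monoʳ-≤ p (⌈/2⌉≤1+⌊/2⌋ LL))

  LL≤L : LL ≤ L
  LL≤L = ℕ.≤-trans (ℕ.n≤1+n LL) (ℕ.≤-trans (1+n≤2^n LL) 2^LL≤L)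

  n≤q^r : n ≤ (2 ^ p) ^ r
  n≤q^r = begin
    n                ≤⟨ ℕ.<⇒≤ (<2^1+log₂ n) ⟩
    2 ^ suc L        ≤⟨ ℕ.^-monoʳ-≤ 2 (begin
      suc L                              ≡⟨ m≡m%n+[m/n]*n (suc L) p ⟩
      suc L % p + suc L / p * p          ≤⟨ ℕ.+-monoˡ-≤ _ (ℕ.<⇒≤ (m%n<n (suc L) p)) ⟩
      r * p                              ≡⟨ ℕ.*-comm r p ⟩
      p * r                              ∎) ⟩
    2 ^ (p * r)      ≡⟨ ℕ.^-*-assoc 2 p r ⟨
    (2 ^ p) ^ r      ∎

  -- Here `LL ≤ 2 * 2 ^ p`, and `2 ^ (p + p) ≤ L` because `p + p ≤ LL`.
  thresholds≤ : 2 ^ p * LL ≤ 2 * L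
  thresholds≤ = begin
    2 ^ p * LL                    ≤⟨ ℕ.*-monoʳ-≤ (2 ^ p) LL≤ ⟩
    2 ^ p * (p + suc p)           ≤⟨ ℕ.*-monoʳ-≤ (2 ^ p) (ℕ.+-mono-≤ (ℕ.≤-trans (ℕ.n≤1+n p) (1+n≤2^n p)) (1+n≤2^n p)) ⟩
    2 ^ p * (2 ^ p + 2 ^ p)       ≡⟨ double (2 ^ p) ⟩
    2 * (2 ^ p * 2 ^ p)           ≡⟨ cong (2 *_) (ℕ.^-distribˡ-+-* 2 p p) ⟨
    2 * 2 ^ (p + p)               ≤⟨ ℕ.*-monoʳ-≤ 2 (ℕ.≤-trans (ℕ.^-monoʳ-≤ 2 p+p≤LL) 2^LL≤L) ⟩
    2 * L                         ∎
    where
    double : ∀ a → a * (a + a) ≡ 2 * (a * a)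
    double = solve-∀

  -- As `p` is positive, `LL` is at most three times `p`, and `r * p ≤ p + suc L ≤ 3 * L`.
  digits≤ : r * LL ≤ 9 * L
  digits≤ = begin
    r * LL                        ≤⟨ ℕ.*-monoʳ-≤ r (ℕ.≤-trans LL≤ (ℕ.+-monoʳ-≤ p (ℕ.+-monoˡ-≤ p 1≤p))) ⟩
    r * (p + (p + p))             ≡⟨ triple (suc L / p) p ⟩
    3 * (p + suc L / p * p)       ≤⟨ ℕ.*-monoʳ-≤ 3 (ℕ.+-mono-≤ p≤L (m/n*n≤m (suc L) p)) ⟩
    3 * (L + suc L)               ≤⟨ ℕ.*-monoʳ-≤ 3 (ℕ.+-monoʳ-≤ L (ℕ.+-monoˡ-≤ L (ℕ.≤-trans (s≤s z≤n) 4≤L))) ⟩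
    3 * (L + (L + L))             ≡⟨ nine L ⟩
    9 * L                         ∎
    where
    p≤L : p ≤ L
    p≤L = ℕ.≤-trans (ℕ.⌊n/2⌋≤n LL) LL≤L
    triple : ∀ a p → suc a * (p + (p + p)) ≡ 3 * (p + a * p)
    triple = solve-∀
    nine : ∀ a → 3 * (a + (a + a)) ≡ 9 * a
    nine = solve-∀

  -- The constant 11 is 2 for the thresholds plus 9 for the digits.
  bound : (2 ^ p + r + k) * LL ≤ (11 + k) * L
  bound = begin
    (2 ^ p + r + k) * LL               ≡⟨ expand (2 ^ p) r k LL ⟩
    2 ^ p * LL + r * LL + k * LL       ≤⟨ ℕ.+-mono-≤ (ℕ.+-mono-≤ thresholds≤ digits≤) (ℕ.*-monoʳ-≤ k LL≤L) ⟩
    2 * L + 9 * L + k * L              ≡⟨ expand 2 9 k L ⟨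
    (11 + k) * L                       ∎
    where
    expand : ∀ a b c d → (a + b + c) * d ≡ a * d + b * d + c * d
    expand = solve-∀

sat-size≤ : ∀ {G : EdgeOrderedGraph k} n {s} → 16 ≤ n → Is-satₘ n (D₀ ⊕ G) s →
            s * ⌊log₂ ⌊log₂ n ⌋ ⌋ ≤ (11 + k) * (n * ⌊log₂ n ⌋)
sat-size≤ {k} {G} n {s} 16≤n least =
  let q , r , n≤q^r , few = hub-count k n 16≤n in begin
  s * LL                        ≤⟨ ℕ.*-monoˡ-≤ LL (sat≤ {G = G} q r n≤q^r least) ⟩
  (q + r + k) * n * LL          ≡⟨ swap (q + r + k) n LL ⟩
  n * ((q + r + k) * LL)        ≤⟨ ℕ.*-monoʳ-≤ n few ⟩
  n * ((11 + k) * ⌊log₂ n ⌋)    ≡⟨ swap′ n (11 + k) ⌊log₂ n ⌋ ⟩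
  (11 + k) * (n * ⌊log₂ n ⌋)    ∎
  where
  open ℕ.≤-Reasoning
  LL = ⌊log₂ ⌊log₂ n ⌋ ⌋
  swap : ∀ a b c → a * b * c ≡ b * (a * c)
  swap = solve-∀
  swap′ : ∀ a b c → a * (b * c) ≡ b * (a * c)
  swap′ = solve-∀

corollary25 : ∀ {k : ℕ} (G : EdgeOrderedGraph k) →
    Σ[ ssatₘ ∈ (ℕ → ℕ) ] Σ[ satₘ ∈ (ℕ → ℕ) ]
    (∀ n → Is-ssatₘ n (D₀ ⊕ G) (ssatₘ n))
    × (∀ n → Is-satₘ n (D₀ ⊕ G) (satₘ n))
    × IsΩ[n√logn] ssatₘ
    × (∀ n → ssatₘ n ≤ satₘ n)
    × IsO[nlogn/loglogn] satₘ
corollary25 {k} G =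
    proj₁ ∘ ssat , proj₁ ∘ sat , proj₂ ∘ ssat , proj₂ ∘ sat
  -- The lower bound starts at `n = 1` because its `d` is a quotient by `n`.
  , (6 , 1 , ssat-large)
  , ssat≤sat
  , (11 + k , 16 , λ n 16≤n → sat-size≤ {G = G} n 16≤n (proj₂ (sat n)))
  where
  ssat : ∀ n → ∃ (Is-ssatₘ n (D₀ ⊕ G))
  ssat n = ssat-exists (D₀ ⊕ G) n (s≤s z≤n)

  sat : ∀ n → ∃ (Is-satₘ n (D₀ ⊕ G))
  sat n = sat-exists (D₀ ⊕ G) n (s≤s z≤n)

  ssat-large : ∀ n → 1 ≤ n → n ^ 2 * ⌊log₂ n ⌋ ≤ (6 * proj₁ (ssat n)) ^ 2
  ssat-large n 1≤n =
    let H , semi , size≡ = IsMinimumSize.attained (proj₂ (ssat n)) in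
    subst (λ s → n ^ 2 * ⌊log₂ n ⌋ ≤ (6 * s) ^ 2) size≡ (semisaturated-size≥ {G = G} H {{>-nonZero 1≤n}} semi)

  ssat≤sat : ∀ n → proj₁ (ssat n) ≤ proj₁ (sat n)
  ssat≤sat n =
    let H , (_ , semi) , size≡ = IsMinimumSize.attained (proj₂ (sat n)) in
    ℕ.≤-trans (IsMinimumSize.minimal (proj₂ (ssat n)) H semi) (ℕ.≤-reflexive size≡)
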